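{- Let $q$ be a positive integer and let $B_q=(S(m,n;q))_{m,n=1}^q$ be the $q\times q$ matrix whose $(m,n)$ entry is the Kloosterman sum $S(m,n;q)$. Then the characteristic polynomial of $B_q$ is \[ \det(\lambda E_q-B_q)=\lambda^{q-\varphi(q)}(\lambda-q)^{\frac{\varphi(q)+\widetilde{\varphi}(q)}{2}}(\lambda+q)^{\frac{\varphi(q)-\widetilde{\varphi}(q)}{2}}. \] In particular, $B_q$ has eigenvalues $0,q,-q$ with multiplicities $q-\varphi(q)$, $\frac{\varphi(q)+\widetilde{\varphi}(q)}{2}$, $\frac{\varphi(q)-\widetilde{\varphi}(q)}{2}$, respectively.
   Context: For positive integer $q$ and integers $m,n$, the Kloosterman sum is $S(m,n;q)=\sum_{1\le k\le q,\ \gcd(k,q)=1}\exp\bigl(\frac{2\pi i}{q}(mk+nk^*)\bigr)$, where $k^*$ denotes an inverse of $k$ modulo $q$. $\varphi$ is Euler's totient function, and $\widetilde{\varphi}(q)=\#\{1\le k\le q:\ \gcd(k,q)=1,\ k+k^*\equiv 0 \pmod q\}$ (equivalently, the number of $1\le k\le q$ coprime to $q$ with $k^2\equiv -1\pmod q$). $E_q$ is the $q\times q$ identity matrix. -}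

module Defs where

open import Level using (Level)
open import Algebra.Bundles using (CommutativeRing)
open import Data.Nat as ℕ using (ℕ; zero; suc; _%_; _∸_; _/_)
open import Data.Nat.GCD using (gcd)
open import Data.Fin using (Fin; zero; suc; toℕ; punchIn)
open import Data.List using (List; []; _∷_; filter; length; upTo; map; foldr)
open import Data.Maybe using (Maybe; just; nothing)
open import Relation.Binary.PropositionalEquality using (_≡_)
open import Relation.Nullary using (¬_)

oneTo : ℕ → List ℕ
oneTo q = map suc (upTo q)

-- an inverse k* of k modulo q: the least j ∈ {1,…,q} with k·j ≡ 1 (mod q);
-- defaults to 0 if none exists (never used for k coprime to q).
findInv : ℕ → ℕ → List ℕ → ℕ
findInv q k []       = 0
findInv q k (j ∷ js) with ((k ℕ.* j) % suc q) ℕ.≟ (1 % suc q)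
... | Relation.Nullary.yes _ = j
... | Relation.Nullary.no  _ = findInv q k js

-- inverse modulo (suc q')  (moduli are positive, written as suc q')
inv : ℕ → ℕ → ℕ
inv q' k = findInv q' k (oneTo (suc q'))

units : ℕ → List ℕ
units q' = filter (λ k → gcd k (suc q') ℕ.≟ 1) (oneTo (suc q'))

φ : ℕ → ℕ
φ q' = length (units q')

φ̃ : ℕ → ℕ
φ̃ q' = length (filter (λ k → ((k ℕ.+ inv q' k) % suc q') ℕ.≟ 0) (units q'))

module _ {c ℓ : Level} (R : CommutativeRing c ℓ) where
  open CommutativeRing R using (Carrier; _≈_; _+_; _*_; -_; _-_; 0#; 1#)

  pow : Carrier → ℕ → Carrier
  pow x zero    = 1#
  pow x (suc n) = x * pow x n

  natR : ℕ → Carrier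
  natR zero    = 0#
  natR (suc n) = 1# + natR n

  sumL : List Carrier → Carrier
  sumL = foldr _+_ 0#

  sumFin : ∀ n → (Fin n → Carrier) → Carrier
  sumFin zero    f = 0#
  sumFin (suc n) f = f zero + sumFin n (λ i → f (suc i))

  -- ζ is a primitive q-th root of unity (q = suc q'), in the form used for
  -- additive characters e(x/q) = ζ^x:  ζ^q = 1 and, for 0 < j < q,
  -- Σ_{m=1}^{q} ζ^{m j} = 0  (orthogonality of additive characters)
  IsPrimitiveRoot : ℕ → Carrier → Set ℓ
  IsPrimitiveRoot q' ζ =
    (pow ζ (suc q') ≈ 1#) ×'
    (∀ j → 0 ℕ.< j → j ℕ.< suc q' → sumL (map (λ m → pow ζ (m ℕ.* j)) (oneTo (suc q'))) ≈ 0#)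
    where open import Data.Product using () renaming (_×_ to _×'_)

  -- Kloosterman sum S(m,n;q) = Σ_{1≤k≤q, gcd(k,q)=1} e((m k + n k*)/q),
  -- with e(x/q) = ζ^x  (q = suc q')
  kloosterman : (q' : ℕ) → Carrier → ℕ → ℕ → Carrier
  kloosterman q' ζ m n =
    sumL (map (λ k → pow ζ (m ℕ.* k ℕ.+ n ℕ.* inv q' k)) (units q'))

  det : ∀ n → (Fin n → Fin n → Carrier) → Carrier
  det zero    M = 1#
  det (suc n) M =
    sumFin (suc n) (λ j →
      pow (- 1#) (toℕ j) * (M zero j * det n (λ a b → M (suc a) (punchIn j b))))

  idM : ∀ n → Fin n → Fin n → Carrier
  idM (suc n) zero    zero    = 1#
  idM (suc n) zero    (suc j) = 0#
  idM (suc n) (suc i) zero    = 0#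
  idM (suc n) (suc i) (suc j) = idM n i j

  Bmat : (q' : ℕ) → Carrier → Fin (suc q') → Fin (suc q') → Carrier
  Bmat q' ζ i j = kloosterman q' ζ (suc (toℕ i)) (suc (toℕ j))

  charPolyAt : (q' : ℕ) → Carrier → Carrier → Carrier
  charPolyAt q' ζ λ' =
    det (suc q') (λ i j → λ' * idM (suc q') i j - Bmat q' ζ i j)

{-# OPTIONS --safe #-}
-- Put e(x) = ζ^x. The Kloosterman matrix factors as B = U V with U_{mk} = e(mk) and
-- V_{kn} = e(n k*) for k coprime to q, V_{kn} = 0 otherwise. By orthogonality
-- (V U)_{kl} = Σ_n e(n (k* + l)) is q if k is coprime to q and l ≡ -k* (mod q), and 0 otherwise.
-- U V and V U have the same characteristic polynomial over every commutative ring, so it remains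
-- to compute det (λ - q N) for the matrix N of the involution k ↦ -k* of the units, extended by
-- zero: a non-unit contributes λ, a fixed point λ - q, and a 2-cycle (λ - q)(λ + q).
module Submission where

open import Defs
open import Level using (Level; _⊔_)
open import Algebra.Bundles using (CommutativeRing)
open import Algebra.Morphism.Structures using (module RingMorphisms)
open import Data.Bool using (Bool; true; false; if_then_else_)
open import Data.Empty using (⊥-elim)
open import Data.Fin using (Fin; zero; suc; toℕ; fromℕ<; punchIn; punchOut; inject₁; _≟_; _↑ˡ_; _↑ʳ_; splitAt; join)
open import Data.Fin.Induction using (<-weakInduction)
open import Data.Fin.Permutation using (Permutation; _⟨$⟩ʳ_; _⟨$⟩ˡ_; inverseʳ; inverseˡ; ↔⇒≡)
open import Data.Fin.Properties using (suc-injective; toℕ-injective; toℕ-fromℕ<; toℕ<n; toℕ-inject₁; toℕ-↑ˡ; ↑ˡ-injective; ↑ʳ-injective; splitAt-↑ˡ; splitAt-↑ʳ; join-splitAt; punchInᵢ≢i; punchIn-punchOut; punchIn-injective)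
open import Data.List using (List; []; _∷_; _++_; map; filter; length; lookup; upTo; applyUpTo)
open import Data.List.Membership.Propositional using (_∈_)
open import Data.List.Membership.Propositional.Properties using (∈-lookup; ∈-∃++; ∈-++⁺ʳ; ∈-++⁻; ∈-map⁺; ∈-map⁻; ∈-upTo⁺; ∈-upTo⁻)
open import Data.List.Properties using (filter-accept; filter-reject; length-map; length-upTo)
open import Data.List.Relation.Binary.Permutation.Homogeneous using (onIndices)
open import Data.List.Relation.Binary.Permutation.Propositional using (_↭_; prep; ↭-sym; ↭⇒↭ₛ)
open import Data.List.Relation.Binary.Permutation.Propositional.Properties using (shift; ∈-resp-↭; ↭-length; filter-↭)
import Data.List.Relation.Binary.Permutation.Setoid.Properties as Permₛ
open import Data.List.Relation.Unary.All as All using ()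
open import Data.List.Relation.Unary.AllPairs using (_∷_)
open import Data.List.Relation.Unary.Any using (here; there)
open import Data.List.Relation.Unary.Unique.Propositional using (Unique)
open import Data.List.Relation.Unary.Unique.Propositional.Properties using (map⁺; upTo⁺)
open import Data.Nat as ℕ using (ℕ; zero; suc; _%_; z<s)
open import Data.Nat.Coprimality using (coprime-Bézout; gcd≡1⇒coprime)
open import Data.Nat.Divisibility using (_∣_; m%n≡0⇒n∣m; ∣m+n∣m⇒∣n; ∣-trans; ∣m⇒∣m*n; ∣1⇒≡1)
open import Data.Nat.DivMod using (%-distribˡ-+; %-distribˡ-*; [m+kn]%n≡m%n; m%n<n; m%n%n≡m%n; m*n%n≡0; m<n⇒m%n≡m; m≡m%n+[m/n]*n; m*n/n≡m)
open import Data.Nat.GCD using (gcd; gcd[m,n]∣m; gcd[m,n]∣n; module Bézout)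
import Data.Nat.Properties as ℕₚ
open import Data.Nat.Tactic.RingSolver using (solve-∀)
open import Data.Product using (_×_; _,_; proj₁; proj₂; ∃-syntax)
open import Data.Sum using (inj₁; inj₂; [_,_]; fromInj₂)
open import Data.Vec.Functional using (insertAt)
open import Data.Vec.Functional.Properties using (insertAt-lookup; insertAt-punchIn)
open import Function using (_∘_; id)
open import Relation.Binary.PropositionalEquality as ≡ using (_≡_; _≢_)
open import Relation.Nullary using (¬_; Dec; yes; no; does)
open import Relation.Nullary.Decidable using (dec-true; dec-false)

-- The block argument that compares `U V` with `V U` gives the equality only up to a factor λ^q,
-- which may be a zero divisor. It is therefore run over `R[X]` with the indeterminate in place of
-- λ; there X^q cancels, and evaluation at λ returns to `R`. Conjugating block matrices requires the
-- product rule, while `det` is given by expansion along the first row. The bridge is the uniqueness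
-- of alternating multilinear forms: each one is `Det` times its value at the identity. Passing to
-- `V U` pays because its entries are only 0 and q, whereas those of `U V` are Kloosterman sums.
-- Keeping zero rows in `V` at the non-units, instead of a factorisation through dimension φ(q),
-- makes both products of size q, so that the same power of λ stands on both sides of the block
-- identity. The halves in the exponents come from counting: the units are the fixed points of k ↦
-- -k* together with pairs, and each pair supplies one factor λ - q and one factor λ + q.

module Determinants {c ℓ : Level} (R : CommutativeRing c ℓ) where
  open CommutativeRing R hiding (zero)
  open import Algebra.Properties.Ring ring using (-0#≈0#; -1*x≈-x; -‿involutive; -‿distribˡ-*; -‿distribʳ-*)
  open import Algebra.Properties.Group +-group using (inverseʳ-unique)
  open import Relation.Binary.Reasoning.Setoid setoid
  open import Algebra.Solver.Ring.NaturalCoefficients.Default commutativeSemiring using (solve; _:+_; _:*_; _:=_)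

  -- Finite sums and matrix products.

  Matrix : ℕ → ℕ → Set c
  Matrix m n = Fin m → Fin n → Carrier

  infix 4 _≋_
  _≋_ : ∀ {m n} → Matrix m n → Matrix m n → Set ℓ
  A ≋ B = ∀ i j → A i j ≈ B i j

  -- Opaque, so that the size and the family can be inferred from a sum or a determinant.
  opaque
    ∑ : ∀ {n} → (Fin n → Carrier) → Carrier
    ∑ {n} = sumFin R n

    Det : ∀ {n} → Matrix n n → Carrier
    Det {n} = det R n

  I : ∀ {n} → Matrix n n
  I {n} = idM R n

  sign : ℕ → Carrier
  sign = pow R (- 1#)

  +-interchange : ∀ a b c d → (a + b) + (c + d) ≈ (a + c) + (b + d)
  +-interchange = solve 4 (λ a b c d → ((a :+ b) :+ (c :+ d)) := ((a :+ c) :+ (b :+ d))) refl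

  opaque
    unfolding ∑

    ∑-def : ∀ {n} (f : Fin n → Carrier) → ∑ f ≡ sumFin R n f
    ∑-def f = ≡.refl

    ∑-suc : ∀ {n} (f : Fin (suc n) → Carrier) → ∑ f ≡ f zero + ∑ (f ∘ suc)
    ∑-suc f = ≡.refl

    ∑-cong : ∀ {n} {f g : Fin n → Carrier} → (∀ i → f i ≈ g i) → ∑ f ≈ ∑ g
    ∑-cong {zero}  f≈g = refl
    ∑-cong {suc n} f≈g = +-cong (f≈g zero) (∑-cong (f≈g ∘ suc))

    ∑-zero : ∀ {n} {f : Fin n → Carrier} → (∀ i → f i ≈ 0#) → ∑ f ≈ 0#
    ∑-zero {zero}  f≈0 = refl
    ∑-zero {suc n} f≈0 = trans (+-cong (f≈0 zero) (∑-zero (f≈0 ∘ suc))) (+-identityʳ 0#)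

    ∑-+ : ∀ {n} (f g : Fin n → Carrier) → ∑ (λ i → f i + g i) ≈ ∑ f + ∑ g
    ∑-+ {zero}  f g = sym (+-identityʳ 0#)
    ∑-+ {suc n} f g = trans (+-congˡ (∑-+ (f ∘ suc) (g ∘ suc))) (+-interchange _ _ _ _)

    ∑-*ˡ : ∀ {n} a (f : Fin n → Carrier) → a * ∑ f ≈ ∑ (λ i → a * f i)
    ∑-*ˡ {zero}  a f = zeroʳ a
    ∑-*ˡ {suc n} a f = trans (distribˡ a _ _) (+-congˡ (∑-*ˡ a (f ∘ suc)))

    ∑-*ʳ : ∀ {n} a (f : Fin n → Carrier) → ∑ f * a ≈ ∑ (λ i → f i * a)
    ∑-*ʳ {zero}  a f = zeroˡ a
    ∑-*ʳ {suc n} a f = trans (distribʳ a _ _) (+-congˡ (∑-*ʳ a (f ∘ suc)))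

    ∑-comm : ∀ {m n} (f : Fin m → Fin n → Carrier) →
             ∑ (λ i → ∑ (f i)) ≈ ∑ (λ j → ∑ (λ i → f i j))
    ∑-comm {zero}  f = sym (∑-zero {f = λ j → ∑ (λ i → f i j)} (λ _ → refl))
    ∑-comm {suc m} f = trans (+-congˡ (∑-comm (f ∘ suc))) (sym (∑-+ (f zero) _))

    ∑-single : ∀ {n} (f : Fin n → Carrier) k → (∀ i → i ≢ k → f i ≈ 0#) → ∑ f ≈ f k
    ∑-single f zero f≈0 =
      trans (+-congˡ (∑-zero (λ i → f≈0 (suc i) λ ()))) (+-identityʳ _)
    ∑-single f (suc k) f≈0 =
      trans (+-cong (f≈0 zero λ ()) (∑-single (f ∘ suc) k (λ i i≢k → f≈0 (suc i) (i≢k ∘ suc-injective))))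
            (+-identityˡ _)

    ∑-split : ∀ m {n} (f : Fin (m ℕ.+ n) → Carrier) →
              ∑ f ≈ ∑ (λ i → f (i ↑ˡ n)) + ∑ (λ j → f (m ↑ʳ j))
    ∑-split zero    f = sym (+-identityˡ _)
    ∑-split (suc m) f = trans (+-congˡ (∑-split m (f ∘ suc))) (sym (+-assoc _ _ _))

  I-diag : ∀ {n} (i : Fin n) → I i i ≈ 1#
  I-diag zero    = refl
  I-diag (suc i) = I-diag i

  I-off : ∀ {n} {i j : Fin n} → i ≢ j → I i j ≈ 0#
  I-off {i = zero}  {zero}  i≢j = ⊥-elim (i≢j ≡.refl)
  I-off {i = zero}  {suc j} i≢j = refl
  I-off {i = suc i} {zero}  i≢j = refl
  I-off {i = suc i} {suc j} i≢j = I-off (i≢j ∘ ≡.cong suc)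

  infixl 7 _·_
  _·_ : ∀ {l m n} → Matrix l m → Matrix m n → Matrix l n
  (A · B) i j = ∑ (λ k → A i k * B k j)

  ∑-Iˡ : ∀ {n} i (f : Fin n → Carrier) → ∑ (λ k → I i k * f k) ≈ f i
  ∑-Iˡ i f = begin
    ∑ (λ k → I i k * f k) ≈⟨ ∑-single _ i (λ k k≢i → trans (*-congʳ (I-off (k≢i ∘ ≡.sym))) (zeroˡ _)) ⟩
    I i i * f i           ≈⟨ *-congʳ (I-diag i) ⟩
    1# * f i              ≈⟨ *-identityˡ _ ⟩
    f i                   ∎

  ∑-Iʳ : ∀ {n} i (f : Fin n → Carrier) → ∑ (λ k → f k * I k i) ≈ f i
  ∑-Iʳ i f = begin
    ∑ (λ k → f k * I k i) ≈⟨ ∑-single _ i (λ k k≢i → trans (*-congˡ (I-off k≢i)) (zeroʳ _)) ⟩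
    f i * I i i           ≈⟨ *-congˡ (I-diag i) ⟩
    f i * 1#              ≈⟨ *-identityʳ _ ⟩
    f i                   ∎

  ·-assoc : ∀ {k l m n} (A : Matrix k l) (B : Matrix l m) (C : Matrix m n) →
            (A · B) · C ≋ A · (B · C)
  ·-assoc A B C i j = begin
    ∑ (λ b → ∑ (λ a → A i a * B a b) * C b j)   ≈⟨ ∑-cong (λ b → ∑-*ʳ (C b j) _) ⟩
    ∑ (λ b → ∑ (λ a → A i a * B a b * C b j))   ≈⟨ ∑-comm _ ⟩
    ∑ (λ a → ∑ (λ b → A i a * B a b * C b j))   ≈⟨ ∑-cong (λ a → ∑-cong (λ b → *-assoc _ _ _)) ⟩
    ∑ (λ a → ∑ (λ b → A i a * (B a b * C b j))) ≈⟨ ∑-cong (λ a → ∑-*ˡ (A i a) _) ⟨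
    ∑ (λ a → A i a * ∑ (λ b → B a b * C b j))   ∎

  -- First-row expansion: the determinant is multilinear and alternating in the rows.

  minor : ∀ {n} → Fin (suc n) → Matrix (suc n) (suc n) → Matrix n n
  minor j A a b = A (suc a) (punchIn j b)

  opaque
    unfolding ∑ Det

    Det-def : ∀ {n} (A : Matrix n n) → Det A ≡ det R n A
    Det-def A = ≡.refl

    Det-zero : (A : Matrix 0 0) → Det A ≡ 1#
    Det-zero A = ≡.refl

    Det-suc : ∀ {n} (A : Matrix (suc n) (suc n)) →
              Det A ≡ ∑ (λ j → sign (toℕ j) * (A zero j * Det (minor j A)))
    Det-suc A = ≡.refl

  Det-cong : ∀ {n} {A B : Matrix n n} → A ≋ B → Det A ≈ Det B
  Det-cong {zero}  {A} {B} A≋B = reflexive (≡.trans (Det-zero A) (≡.sym (Det-zero B)))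
  Det-cong {suc n} {A} {B} A≋B = begin
    Det A                                                 ≡⟨ Det-suc A ⟩
    ∑ (λ j → sign (toℕ j) * (A zero j * Det (minor j A))) ≈⟨ ∑-cong (λ j →
      *-congˡ (*-cong (A≋B zero j) (Det-cong (λ a b → A≋B (suc a) (punchIn j b))))) ⟩
    ∑ (λ j → sign (toℕ j) * (B zero j * Det (minor j B))) ≡⟨ Det-suc B ⟨
    Det B                                                 ∎

  -- Linearity in row `i` is a relation between three matrices that agree off that row, so its uses
  -- involve no row-update operation. The single form `a * B + C` contains additivity (`a = 1#`)
  -- and, with `a = - 1#`, the vanishing on a zero row.
  record Multilinear {n} (F : Matrix n n → Carrier) : Set (c ⊔ ℓ) where
    field
      cong   : ∀ {A B} → A ≋ B → F A ≈ F B
      linear : ∀ i a {A B C} →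
               (∀ k → k ≢ i → ∀ j → A k j ≈ B k j) →
               (∀ k → k ≢ i → ∀ j → A k j ≈ C k j) →
               (∀ j → A i j ≈ a * B i j + C i j) →
               F A ≈ a * F B + F C

  -- Vanishing on repeated rows is the stronger notion: a change of sign under exchange would only
  -- give `F A + F A ≈ 0#`, and 2 may be a zero divisor in `R`.
  AlternatingAt : ∀ {n} → (Matrix n n → Carrier) → Fin n → Fin n → Set (c ⊔ ℓ)
  AlternatingAt F i k = ∀ A → (∀ j → A i j ≈ A k j) → F A ≈ 0#

  record Alternating {n} (F : Matrix n n → Carrier) : Set (c ⊔ ℓ) where
    field
      multilinear : Multilinear F
      alternating : ∀ {i k} → i ≢ k → AlternatingAt F i k
    open Multilinear multilinear public

  Det-multilinear : ∀ {n} → Multilinear (Det {n})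
  Det-multilinear = record { cong = Det-cong ; linear = linear }
    where
    linear : ∀ {n} (i : Fin n) a {A B C} →
             (∀ k → k ≢ i → ∀ j → A k j ≈ B k j) →
             (∀ k → k ≢ i → ∀ j → A k j ≈ C k j) →
             (∀ j → A i j ≈ a * B i j + C i j) →
             Det A ≈ a * Det B + Det C
    linear {suc n} zero a {A} {B} {C} A≈B A≈C A≈aB+C = begin
      Det A
        ≡⟨ Det-suc A ⟩
      ∑ (λ j → sign (toℕ j) * (A zero j * Det (minor j A)))
        ≈⟨ ∑-cong (λ j → trans (*-congˡ (*-congʳ (A≈aB+C j))) (trans (rearrange _ _ _ _ _) (+-cong
             (*-congˡ (*-congˡ (*-congˡ (Det-cong λ k b → A≈B (suc k) (λ ()) (punchIn j b)))))
             (*-congˡ (*-congˡ (Det-cong λ k b → A≈C (suc k) (λ ()) (punchIn j b))))))) ⟩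
      ∑ (λ j → a * (sign (toℕ j) * (B zero j * Det (minor j B))) + sign (toℕ j) * (C zero j * Det (minor j C)))
        ≈⟨ ∑-+ _ _ ⟩
      ∑ (λ j → a * (sign (toℕ j) * (B zero j * Det (minor j B)))) + ∑ (λ j → sign (toℕ j) * (C zero j * Det (minor j C)))
        ≈⟨ +-cong (trans (sym (∑-*ˡ a _)) (*-congˡ (reflexive (≡.sym (Det-suc B))))) (reflexive (≡.sym (Det-suc C))) ⟩
      a * Det B + Det C ∎
      where
      rearrange : ∀ s a b c d → s * ((a * b + c) * d) ≈ a * (s * (b * d)) + s * (c * d)
      rearrange = solve 5 (λ s a b c d → (s :* ((a :* b :+ c) :* d)) := (a :* (s :* (b :* d)) :+ s :* (c :* d))) refl
    linear {suc n} (suc i) a {A} {B} {C} A≈B A≈C A≈aB+C = begin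
      Det A
        ≡⟨ Det-suc A ⟩
      ∑ (λ j → sign (toℕ j) * (A zero j * Det (minor j A)))
        ≈⟨ ∑-cong (λ j → trans
             (*-congˡ (*-congˡ (linear i a
                (λ k k≢i b → A≈B (suc k) (k≢i ∘ suc-injective) (punchIn j b))
                (λ k k≢i b → A≈C (suc k) (k≢i ∘ suc-injective) (punchIn j b))
                (λ b → A≈aB+C (punchIn j b)))))
             (trans (rearrange _ _ _ _ _) (+-cong
                (*-congˡ (*-congˡ (*-congʳ (A≈B zero (λ ()) j))))
                (*-congˡ (*-congʳ (A≈C zero (λ ()) j)))))) ⟩
      ∑ (λ j → a * (sign (toℕ j) * (B zero j * Det (minor j B))) + sign (toℕ j) * (C zero j * Det (minor j C)))
        ≈⟨ ∑-+ _ _ ⟩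
      ∑ (λ j → a * (sign (toℕ j) * (B zero j * Det (minor j B)))) + ∑ (λ j → sign (toℕ j) * (C zero j * Det (minor j C)))
        ≈⟨ +-cong (trans (sym (∑-*ˡ a _)) (*-congˡ (reflexive (≡.sym (Det-suc B))))) (reflexive (≡.sym (Det-suc C))) ⟩
      a * Det B + Det C ∎
      where
      rearrange : ∀ s a b d e → s * (b * (a * d + e)) ≈ a * (s * (b * d)) + s * (b * e)
      rearrange = solve 5 (λ s a b d e → (s :* (b :* (a :* d :+ e))) := (a :* (s :* (b :* d)) :+ s :* (b :* e))) refl

  sign-suc-cancel : ∀ s x y → x ≈ y → s * (1# * x) + (- 1# * s) * (1# * y) ≈ 0#
  sign-suc-cancel s x y x≈y = begin
    s * (1# * x) + (- 1# * s) * (1# * y)   ≈⟨ +-congʳ (*-congˡ (*-congˡ x≈y)) ⟩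
    s * (1# * y) + (- 1# * s) * (1# * y)   ≈⟨ distribʳ _ s (- 1# * s) ⟨
    (s + - 1# * s) * (1# * y)              ≈⟨ *-congʳ (+-congˡ (-1*x≈-x s)) ⟩
    (s - s) * (1# * y)                     ≈⟨ *-congʳ (-‿inverseʳ s) ⟩
    0# * (1# * y)                          ≈⟨ zeroˡ _ ⟩
    0#                                     ∎

  -- K x y e is the term of the double expansion that selects the columns x and y and keeps
  -- the columns e; the terms selecting (x, y) and (y, x) cancel.
  double-expansion-vanishes : ∀ {n} (K : Fin (suc (suc n)) → Fin (suc (suc n)) → (Fin n → Fin (suc (suc n))) → Carrier) →
    (∀ x y e → K x y e ≈ K y x e) →
    (∀ x y {e e′} → (∀ b → e b ≡ e′ b) → K x y e ≈ K x y e′) →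
    ∑ (λ j → ∑ (λ k → sign (toℕ j) * (sign (toℕ k) * K j (punchIn j k) (punchIn j ∘ punchIn k)))) ≈ 0#
  double-expansion-vanishes {n} K K-sym K-ext = begin
    ∑ (λ j → ∑ (h j))
      ≡⟨ ∑-suc _ ⟩
    ∑ (h zero) + ∑ (λ j → ∑ (h (suc j)))
      ≈⟨ +-congˡ (∑-cong (λ j → reflexive (∑-suc (h (suc j))))) ⟩
    ∑ (h zero) + ∑ (λ j → h (suc j) zero + ∑ (λ k → h (suc j) (suc k)))
      ≈⟨ +-congˡ (∑-+ _ _) ⟩
    ∑ (h zero) + (∑ (λ j → h (suc j) zero) + ∑ (λ j → ∑ (λ k → h (suc j) (suc k))))
      ≈⟨ +-assoc _ _ _ ⟨
    ∑ (h zero) + ∑ (λ j → h (suc j) zero) + ∑ (λ j → ∑ (λ k → h (suc j) (suc k)))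
      ≈⟨ +-cong (trans (sym (∑-+ _ _)) (∑-zero first)) (rest n K K-sym K-ext) ⟩
    0# + 0#
      ≈⟨ +-identityʳ 0# ⟩
    0# ∎
    where
    h : Fin (suc (suc n)) → Fin (suc n) → Carrier
    h j k = sign (toℕ j) * (sign (toℕ k) * K j (punchIn j k) (punchIn j ∘ punchIn k))

    -- Both terms select the columns `zero` and `suc k`, in opposite orders, and keep the same
    -- columns; their signs differ by one factor `- 1#`.
    first : ∀ k → h zero k + h (suc k) zero ≈ 0#
    first k = trans (+-congʳ (swap-1 _ _)) (sign-suc-cancel (sign (toℕ k)) _ _ (K-sym zero (suc k) _))
      where
      swap-1 : ∀ s x → 1# * (s * x) ≈ s * (1# * x)
      swap-1 s x = trans (*-identityˡ _) (*-congˡ (sym (*-identityˡ x)))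

    -- Neither selected column is `zero`, so `zero` is among the kept ones. Dropping it lowers every
    -- index by one, the two sign changes cancel, and the claim recurs for `K′` with one column
    -- fewer. The maps of kept columns agree only pointwise, which `K-ext` absorbs.
    rest : ∀ n (K : Fin (suc (suc n)) → Fin (suc (suc n)) → (Fin n → Fin (suc (suc n))) → Carrier) →
      (∀ x y e → K x y e ≈ K y x e) →
      (∀ x y {e e′} → (∀ b → e b ≡ e′ b) → K x y e ≈ K x y e′) →
      ∑ {suc n} (λ j → ∑ {n} (λ k → sign (suc (toℕ j)) * (sign (suc (toℕ k)) *
        K (suc j) (suc (punchIn j k)) (punchIn (suc j) ∘ punchIn (suc k))))) ≈ 0#
    rest zero    K K-sym K-ext = ∑-zero λ j → ∑-zero λ ()
    rest (suc n) K K-sym K-ext = begin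
      ∑ (λ j → ∑ (λ k → sign (suc (toℕ j)) * (sign (suc (toℕ k)) *
        K (suc j) (suc (punchIn j k)) (punchIn (suc j) ∘ punchIn (suc k)))))
        ≈⟨ ∑-cong (λ j → ∑-cong λ k → trans (cancel-signs _ _ _) (*-congˡ (*-congˡ
             (K-ext _ _ λ { zero → ≡.refl ; (suc b) → ≡.refl })))) ⟩
      ∑ (λ j → ∑ (λ k → sign (toℕ j) * (sign (toℕ k) * K′ j (punchIn j k) (punchIn j ∘ punchIn k))))
        ≈⟨ double-expansion-vanishes K′ (λ x y e → K-sym _ _ _)
             (λ x y e≡e′ → K-ext _ _ λ { zero → ≡.refl ; (suc b) → ≡.cong suc (e≡e′ b) }) ⟩
      0# ∎
      where
      lift : (Fin n → Fin (suc (suc n))) → Fin (suc n) → Fin (suc (suc (suc n)))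
      lift e zero    = zero
      lift e (suc b) = suc (e b)

      K′ : Fin (suc (suc n)) → Fin (suc (suc n)) → (Fin n → Fin (suc (suc n))) → Carrier
      K′ x y e = K (suc x) (suc y) (lift e)

      cancel-signs : ∀ s t x → (- 1# * s) * ((- 1# * t) * x) ≈ s * (t * x)
      cancel-signs s t x = begin
        (- 1# * s) * ((- 1# * t) * x)   ≈⟨ *-cong (-1*x≈-x s) (trans (*-congʳ (-1*x≈-x t)) (sym (-‿distribˡ-* t x))) ⟩
        - s * - (t * x)                 ≈⟨ -‿distribˡ-* s _ ⟨
        - (s * - (t * x))               ≈⟨ -‿cong (sym (-‿distribʳ-* s _)) ⟩
        - - (s * (t * x))               ≈⟨ -‿involutive _ ⟩
        s * (t * x)                     ∎

  -- In the expansion along the first two rows, the columns `x`, `y` carry the weight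
  -- `A zero x * A (suc zero) y`. Equal rows make it symmetric in `x` and `y`, while the signs are
  -- antisymmetric.
  Det-alternating₀₁ : ∀ {n} → AlternatingAt (Det {suc (suc n)}) zero (suc zero)
  Det-alternating₀₁ {n} A A₀≈A₁ = begin
    Det A
      ≡⟨ Det-suc A ⟩
    ∑ (λ j → sign (toℕ j) * (A zero j * Det (minor j A)))
      ≈⟨ ∑-cong (λ j → *-congˡ (trans (*-congˡ (reflexive (Det-suc (minor j A)))) (∑-*ˡ _ _))) ⟩
    ∑ (λ j → sign (toℕ j) * ∑ (λ k → A zero j * (sign (toℕ k) * (A (suc zero) (punchIn j k) * Det (minor k (minor j A))))))
      ≈⟨ ∑-cong (λ j → ∑-*ˡ _ _) ⟩
    ∑ (λ j → ∑ (λ k → sign (toℕ j) * (A zero j * (sign (toℕ k) * (A (suc zero) (punchIn j k) * Det (minor k (minor j A)))))))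
      ≈⟨ ∑-cong (λ j → ∑-cong λ k → *-congˡ (rearrange _ _ _ _)) ⟩
    ∑ (λ j → ∑ (λ k → sign (toℕ j) * (sign (toℕ k) * K j (punchIn j k) (punchIn j ∘ punchIn k))))
      ≈⟨ double-expansion-vanishes K
           (λ x y e → *-congʳ (trans (*-comm _ _) (*-cong (sym (A₀≈A₁ y)) (A₀≈A₁ x))))
           (λ x y e≡e′ → *-congˡ (Det-cong λ a b → reflexive (≡.cong (A (suc (suc a))) (e≡e′ b)))) ⟩
    0# ∎
    where
    K : Fin (suc (suc n)) → Fin (suc (suc n)) → (Fin n → Fin (suc (suc n))) → Carrier
    K x y e = (A zero x * A (suc zero) y) * Det (λ a b → A (suc (suc a)) (e b))

    rearrange : ∀ a s b d → a * (s * (b * d)) ≈ s * ((a * b) * d)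
    rearrange = solve 4 (λ a s b d → (a :* (s :* (b :* d))) := (s :* ((a :* b) :* d))) refl

  additive : ∀ {n} {F : Matrix n n → Carrier} → Multilinear F → ∀ i {A B C} →
             (∀ k → k ≢ i → ∀ j → A k j ≈ B k j) →
             (∀ k → k ≢ i → ∀ j → A k j ≈ C k j) →
             (∀ j → A i j ≈ B i j + C i j) →
             F A ≈ F B + F C
  additive F-multilinear i A≈B A≈C A≈B+C =
    trans (Multilinear.linear F-multilinear i 1# A≈B A≈C (λ j → trans (A≈B+C j) (+-congʳ (sym (*-identityˡ _)))))
          (+-congʳ (*-identityˡ _))

  setRows : ∀ {n} → Matrix n n → Fin n → Fin n → (Fin n → Carrier) → (Fin n → Carrier) → Matrix n n
  setRows A i k x y l with l ≟ i | l ≟ k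
  ... | yes _ | _     = x
  ... | no  _ | yes _ = y
  ... | no  _ | no  _ = A l

  module _ {n} (A : Matrix n n) (i k : Fin n) where
    setRows-first : ∀ x y j → setRows A i k x y i j ≈ x j
    setRows-first x y j with i ≟ i
    ... | yes _   = refl
    ... | no  i≢i = ⊥-elim (i≢i ≡.refl)

    setRows-second : i ≢ k → ∀ x y j → setRows A i k x y k j ≈ y j
    setRows-second i≢k x y j with k ≟ i | k ≟ k
    ... | yes k≡i | _       = ⊥-elim (i≢k (≡.sym k≡i))
    ... | no  _   | yes _   = refl
    ... | no  _   | no  k≢k = ⊥-elim (k≢k ≡.refl)

    setRows-other : ∀ x y {l} → l ≢ i → l ≢ k → ∀ j → setRows A i k x y l j ≈ A l j
    setRows-other x y {l} l≢i l≢k j with l ≟ i | l ≟ k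
    ... | yes l≡i | _       = ⊥-elim (l≢i l≡i)
    ... | no  _   | yes l≡k = ⊥-elim (l≢k l≡k)
    ... | no  _   | no  _   = refl

    setRows-cong-≢first : ∀ x x′ y l → l ≢ i → ∀ j → setRows A i k x y l j ≈ setRows A i k x′ y l j
    setRows-cong-≢first x x′ y l l≢i j with l ≟ i | l ≟ k
    ... | yes l≡i | _     = ⊥-elim (l≢i l≡i)
    ... | no  _   | yes _ = refl
    ... | no  _   | no  _ = refl

    setRows-cong-≢second : ∀ x y y′ l → l ≢ k → ∀ j → setRows A i k x y l j ≈ setRows A i k x y′ l j
    setRows-cong-≢second x y y′ l l≢k j with l ≟ i | l ≟ k
    ... | yes _ | _       = refl
    ... | no  _ | yes l≡k = ⊥-elim (l≢k l≡k)
    ... | no  _ | no  _   = refl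

  -- Polarisation: with `w = u + v` in both rows, `F (M w w)` expands into four terms, and `M u u`,
  -- `M v v` and `M w w` each have a repeated row. Alternation is assumed at the one pair `i`, `k`,
  -- so the lemma can be applied to the first two rows before `Det` is known to alternate in
  -- general.
  swap-rows : ∀ {n} {F : Matrix n n → Carrier} → Multilinear F → ∀ {i k} → i ≢ k → AlternatingAt F i k →
              ∀ {A B} → (∀ j → B i j ≈ A k j) → (∀ j → B k j ≈ A i j) →
              (∀ l → l ≢ i → l ≢ k → ∀ j → B l j ≈ A l j) → F B ≈ - F A
  swap-rows {n} {F} F-multilinear {i} {k} i≢k F-alternating {A} {B} Bi≈Ak Bk≈Ai B≈A =
    inverseʳ-unique (F A) (F B) (begin
      F A + F B
        ≈⟨ +-cong (cong A≋uv) (cong B≋vu) ⟩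
      F (M u v) + F (M v u)
        ≈⟨ +-cong (trans (sym (+-identityˡ _)) (+-congʳ (sym (Mxx≈0 u))))
                  (trans (sym (+-identityʳ _)) (+-congˡ (sym (Mxx≈0 v)))) ⟩
      (F (M u u) + F (M u v)) + (F (M v u) + F (M v v))
        ≈⟨ +-cong (second u) (second v) ⟨
      F (M u w) + F (M v w)
        ≈⟨ additive F-multilinear i
             (setRows-cong-≢first A i k w u w) (setRows-cong-≢first A i k w v w)
             (λ j → trans (setRows-first A i k w w j) (sym (+-cong (setRows-first A i k u w j) (setRows-first A i k v w j)))) ⟨
      F (M w w)
        ≈⟨ Mxx≈0 w ⟩
      0# ∎)
    where
    open Multilinear F-multilinear
    u v w : Fin n → Carrier
    u = A i
    v = A k
    w j = u j + v j

    M : (Fin n → Carrier) → (Fin n → Carrier) → Matrix n n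
    M = setRows A i k

    Mxx≈0 : ∀ x → F (M x x) ≈ 0#
    Mxx≈0 x = F-alternating (M x x) λ j →
      trans (setRows-first A i k x x j) (sym (setRows-second A i k i≢k x x j))

    second : ∀ x → F (M x w) ≈ F (M x u) + F (M x v)
    second x = additive F-multilinear k
      (setRows-cong-≢second A i k x w u) (setRows-cong-≢second A i k x w v)
      (λ j → trans (setRows-second A i k i≢k x w j)
                   (sym (+-cong (setRows-second A i k i≢k x u j) (setRows-second A i k i≢k x v j))))

    A≋uv : A ≋ M u v
    A≋uv l j with l ≟ i | l ≟ k
    ... | yes ≡.refl | _          = refl
    ... | no  _      | yes ≡.refl = refl
    ... | no  _      | no  _      = refl

    B≋vu : B ≋ M v u
    B≋vu l j with l ≟ i | l ≟ k
    ... | yes ≡.refl | _          = Bi≈Ak j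
    ... | no  _      | yes ≡.refl = Bk≈Ai j
    ... | no  l≢i    | no  l≢k    = B≈A l l≢i l≢k j

  Det-alternating-suc : ∀ {n} → (∀ {i k : Fin n} → i ≢ k → AlternatingAt Det i k) →
                        ∀ {i k : Fin n} → i ≢ k → AlternatingAt Det (suc i) (suc k)
  Det-alternating-suc alternating i≢k A Ai≈Ak = begin
    Det A
      ≡⟨ Det-suc A ⟩
    ∑ (λ j → sign (toℕ j) * (A zero j * Det (minor j A)))
      ≈⟨ ∑-zero (λ j → trans (*-congˡ (trans (*-congˡ
           (alternating i≢k (minor j A) (Ai≈Ak ∘ punchIn j))) (zeroʳ _))) (zeroʳ _)) ⟩
    0# ∎

  -- The expansion treats row `zero` apart from the others. If it agrees with a row below the
  -- second, exchanging the first two rows moves the repeated pair entirely below row `zero`, where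
  -- it lies inside every minor.
  Det-alternating₀ : ∀ {n} → (∀ {i k : Fin n} → i ≢ k → AlternatingAt Det i k) →
                     ∀ (k : Fin n) → AlternatingAt Det zero (suc k)
  Det-alternating₀ alternating zero    A A₀≈Ak = Det-alternating₀₁ A A₀≈Ak
  Det-alternating₀ {suc n} alternating (suc k) A A₀≈Ak = begin
    Det A       ≈⟨ -‿involutive _ ⟨
    - - Det A   ≈⟨ -‿cong (swap-rows Det-multilinear {zero} {suc zero} (λ ()) Det-alternating₀₁ {A} {B}
                     (λ _ → refl) (λ _ → refl) B≈A) ⟨
    - Det B     ≈⟨ -‿cong (Det-alternating-suc alternating {zero} {suc k} (λ ()) B A₀≈Ak) ⟩
    - 0#        ≈⟨ -0#≈0# ⟩
    0#          ∎
    where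
    B : Matrix (suc (suc n)) (suc (suc n))
    B zero          = A (suc zero)
    B (suc zero)    = A zero
    B (suc (suc l)) = A (suc (suc l))

    B≈A : ∀ l → l ≢ zero → l ≢ suc zero → ∀ j → B l j ≈ A l j
    B≈A zero          l≢0 l≢1 j = ⊥-elim (l≢0 ≡.refl)
    B≈A (suc zero)    l≢0 l≢1 j = ⊥-elim (l≢1 ≡.refl)
    B≈A (suc (suc l)) l≢0 l≢1 j = refl

  Det-alternating : ∀ {n} {i k : Fin n} → i ≢ k → AlternatingAt Det i k
  Det-alternating {i = zero}  {zero}  i≢k = ⊥-elim (i≢k ≡.refl)
  Det-alternating {i = zero}  {suc k} i≢k = Det-alternating₀ Det-alternating k
  Det-alternating {i = suc i} {zero}  i≢k A Ai≈Ak = Det-alternating₀ Det-alternating i A (sym ∘ Ai≈Ak)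
  Det-alternating {i = suc i} {suc k} i≢k = Det-alternating-suc Det-alternating (i≢k ∘ ≡.cong suc)

  -- Uniqueness of alternating multilinear forms, the product rule and conjugation.

  cons : ∀ {m n} → (Fin n → Carrier) → Matrix m n → Matrix (suc m) n
  cons v A zero    = v
  cons v A (suc i) = A i

  linear-combination : ∀ {n} {F : Matrix (suc n) (suc n) → Carrier} → Multilinear F → ∀ {m}
    (a : Fin m → Carrier) (V : Matrix m (suc n)) (T : Matrix n (suc n)) →
    F (cons (λ j → ∑ (λ k → a k * V k j)) T) ≈ ∑ (λ k → a k * F (cons (V k) T))
  linear-combination {n} {F} F-multilinear {zero} a V T = begin
    -- The empty combination is a zero row, hence `- 1#` times itself plus itself, and linearity
    -- gives `- F A + F A`.
    F A                ≈⟨ linear zero (- 1#) {A} {A} {A} (λ _ _ _ → refl) (λ _ _ _ → refl)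
                            (λ j → trans 0≈ (sym (trans (+-congʳ (-1*x≈-x _)) (-‿inverseˡ _)))) ⟩
    - 1# * F A + F A   ≈⟨ +-congʳ (-1*x≈-x _) ⟩
    - F A + F A        ≈⟨ -‿inverseˡ _ ⟩
    0#                 ≈⟨ ∑-zero (λ ()) ⟨
    ∑ (λ k → a k * F (cons (V k) T)) ∎
    where
    open Multilinear F-multilinear
    A : Matrix (suc n) (suc n)
    A = cons (λ j → ∑ (λ k → a k * V k j)) T
    0≈ : ∀ {f : Fin 0 → Carrier} → ∑ f ≈ 0#
    0≈ = ∑-zero λ ()
  linear-combination {n} {F} F-multilinear {suc m} a V T = begin
    F (cons (λ j → ∑ (λ k → a k * V k j)) T)
      ≈⟨ linear zero (a zero) {B = cons (V zero) T} {cons (λ j → ∑ (λ k → a (suc k) * V (suc k) j)) T}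
           (λ { zero 0≢0 → ⊥-elim (0≢0 ≡.refl) ; (suc k) _ j → refl })
           (λ { zero 0≢0 → ⊥-elim (0≢0 ≡.refl) ; (suc k) _ j → refl })
           (λ j → reflexive (∑-suc _)) ⟩
    a zero * F (cons (V zero) T) + F (cons (λ j → ∑ (λ k → a (suc k) * V (suc k) j)) T)
      ≈⟨ +-congˡ (linear-combination F-multilinear (a ∘ suc) (V ∘ suc) T) ⟩
    a zero * F (cons (V zero) T) + ∑ (λ k → a (suc k) * F (cons (V (suc k)) T))
      ≡⟨ ∑-suc _ ⟨
    ∑ (λ k → a k * F (cons (V k) T)) ∎
    where open Multilinear F-multilinear

  -- The added summand contributes `a` times the value of `F` at `B` with row `k` repeated in row
  -- `i`.
  add-multiple-of-row : ∀ {n} {F : Matrix n n → Carrier} → Alternating F → ∀ {i k} a → i ≢ k → ∀ {A B} →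
    (∀ l → l ≢ i → ∀ j → A l j ≈ B l j) → (∀ j → A i j ≈ a * B k j + B i j) → F A ≈ F B
  add-multiple-of-row {n} {F} F-alt {i} {k} a i≢k {A} {B} A≈B Ai≈ = begin
    F A             ≈⟨ linear i a A≈C A≈B (λ j → trans (Ai≈ j) (+-congʳ (*-congˡ (sym (C-first j))))) ⟩
    a * F C + F B   ≈⟨ +-congʳ (*-congˡ (alternating i≢k C λ j → trans (C-first j) (sym (C-second j)))) ⟩
    a * 0# + F B    ≈⟨ trans (+-congʳ (zeroʳ a)) (+-identityˡ _) ⟩
    F B             ∎
    where
    open Alternating F-alt
    C : Matrix n n
    C = setRows B i k (B k) (B k)
    C-first : ∀ j → C i j ≈ B k j
    C-first = setRows-first B i k (B k) (B k)
    C-second : ∀ j → C k j ≈ B k j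
    C-second = setRows-second B i k i≢k (B k) (B k)
    A≈C : ∀ l → l ≢ i → ∀ j → A l j ≈ C l j
    A≈C l l≢i j = trans (A≈B l l≢i j) (sym (helper (l ≟ k)))
      where
      helper : Dec (l ≡ k) → C l j ≈ B l j
      helper (yes ≡.refl) = C-second j
      helper (no  l≢k)    = setRows-other B i k (B k) (B k) l≢i l≢k j

  add-multiples-of-first-row : ∀ {n} {F : Matrix (suc n) (suc n) → Carrier} → Alternating F →
    ∀ (t : Fin n → Carrier) (A : Matrix (suc n) (suc n)) →
    F (cons (A zero) (λ a j → t a * A zero j + A (suc a) j)) ≈ F A
  add-multiples-of-first-row {n} {F} F-alt t A = begin
    F (cons (A zero) (λ a j → t a * A zero j + A (suc a) j))
      ≈⟨ cong (λ { zero j → refl ; (suc a) j → sym (reflexive (partial-< n a j (toℕ<n a))) }) ⟩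
    F (partial n)
      ≈⟨ F-partial n ℕₚ.≤-refl ⟩
    F A ∎
    where
    open Alternating F-alt
    -- Only the first `m` rows below row `zero` are modified in `partial m`, so consecutive matrices
    -- differ by a single row operation.
    partial : ℕ → Matrix (suc n) (suc n)
    partial m zero    j = A zero j
    partial m (suc a) j with toℕ a ℕ.<? m
    ... | yes _ = t a * A zero j + A (suc a) j
    ... | no  _ = A (suc a) j

    partial-< : ∀ m a j → toℕ a ℕ.< m → partial m (suc a) j ≡ t a * A zero j + A (suc a) j
    partial-< m a j a<m with toℕ a ℕ.<? m
    ... | yes _   = ≡.refl
    ... | no  a≮m = ⊥-elim (a≮m a<m)

    partial-≮ : ∀ m a j → toℕ a ℕ.≮ m → partial m (suc a) j ≡ A (suc a) j
    partial-≮ m a j a≮m with toℕ a ℕ.<? m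
    ... | yes a<m = ⊥-elim (a≮m a<m)
    ... | no  _   = ≡.refl

    F-partial : ∀ m → m ℕ.≤ n → F (partial m) ≈ F A
    F-partial zero    _   = cong λ { zero j → refl ; (suc a) j → reflexive (partial-≮ 0 a j λ ()) }
    F-partial (suc m) m<n = trans (add-multiple-of-row F-alt {suc i} {zero} (t i) (λ ()) others this) (F-partial m (ℕₚ.<⇒≤ m<n))
      where
      i : Fin n
      i = fromℕ< m<n
      i≡m : toℕ i ≡ m
      i≡m = toℕ-fromℕ< m<n
      others : ∀ l → l ≢ suc i → ∀ j → partial (suc m) l j ≈ partial m l j
      others zero    l≢i j = refl
      others (suc a) l≢i j with toℕ a ℕ.<? m
      ... | yes a<m = reflexive (partial-< (suc m) a j (ℕₚ.m<n⇒m<1+n a<m))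
      ... | no  a≮m = reflexive (partial-≮ (suc m) a j λ a<1+m →
        l≢i (≡.cong suc (toℕ-injective (≡.trans (ℕₚ.≤-antisym (ℕ.s≤s⁻¹ a<1+m) (ℕₚ.≮⇒≥ a≮m)) (≡.sym i≡m)))))
      this : ∀ j → partial (suc m) (suc i) j ≈ t i * A zero j + partial m (suc i) j
      this j = trans (reflexive (partial-< (suc m) i j (ℕₚ.≤-reflexive (≡.cong suc i≡m))))
                     (+-congˡ (sym (reflexive (partial-≮ m i j (ℕₚ.<-irrefl i≡m)))))

  -- A right inverse of `minor j`. Pulling a form back along it lowers the size by one, which is
  -- what drives the induction in `Det-unique`.
  border : ∀ {n} → Fin (suc n) → Matrix n n → Matrix (suc n) (suc n)
  border j C = cons (I j) (λ a → insertAt (C a) j 0#)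

  punchIn-cases : ∀ {p} {n} (P : Fin (suc n) → Set p) j → P j → (∀ b → P (punchIn j b)) → ∀ l → P l
  punchIn-cases P j Pj Ppunch l with j ≟ l
  ... | yes ≡.refl = Pj
  ... | no  j≢l    = ≡.subst P (punchIn-punchOut j≢l) (Ppunch (punchOut j≢l))

  -- Subtracting `T a j` times the unit vector in the first row from row `a` clears column `j` and
  -- leaves all other columns alone.
  clear-column : ∀ {n} {F : Matrix (suc n) (suc n) → Carrier} → Alternating F → ∀ j (T : Matrix n (suc n)) →
                 F (cons (I j) T) ≈ F (border j (λ a b → T a (punchIn j b)))
  clear-column {F = F} F-alt j T = begin
    F (cons (I j) T)
      ≈⟨ add-multiples-of-first-row F-alt (λ a → - T a j) (cons (I j) T) ⟨
    F (cons (I j) (λ a l → - T a j * I j l + T a l))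
      ≈⟨ cong (λ { zero l → refl ; (suc a) l → punchIn-cases (λ l → - T a j * I j l + T a l ≈ insertAt (λ b → T a (punchIn j b)) j 0# l)
           j (at-j a) (elsewhere a) l }) ⟩
    F (border j (λ a b → T a (punchIn j b))) ∎
    where
    open Alternating F-alt
    at-j : ∀ a → - T a j * I j j + T a j ≈ insertAt (λ b → T a (punchIn j b)) j 0# j
    at-j a = begin
      - T a j * I j j + T a j   ≈⟨ +-congʳ (trans (*-congˡ (I-diag j)) (*-identityʳ _)) ⟩
      - T a j + T a j           ≈⟨ -‿inverseˡ _ ⟩
      0#                        ≡⟨ insertAt-lookup _ j 0# ⟨
      insertAt (λ b → T a (punchIn j b)) j 0# j ∎
    elsewhere : ∀ a b → - T a j * I j (punchIn j b) + T a (punchIn j b) ≈ insertAt (λ b → T a (punchIn j b)) j 0# (punchIn j b)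
    elsewhere a b = begin
      - T a j * I j (punchIn j b) + T a (punchIn j b)
        ≈⟨ +-congʳ (trans (*-congˡ (I-off (punchInᵢ≢i j b ∘ ≡.sym))) (zeroʳ _)) ⟩
      0# + T a (punchIn j b)
        ≈⟨ +-identityˡ _ ⟩
      T a (punchIn j b)
        ≡⟨ insertAt-punchIn _ j 0# b ⟨
      insertAt (λ b → T a (punchIn j b)) j 0# (punchIn j b) ∎

  border-cases : ∀ {n} j (C : Matrix n n) (P : Fin n → Fin (suc n) → Carrier → Set ℓ) → (∀ a → P a j 0#) →
                 (∀ a b → P a (punchIn j b) (C a b)) → ∀ a l → P a l (border j C (suc a) l)
  border-cases j C P Pj Pb a = punchIn-cases (λ l → P a l (border j C (suc a) l)) j
    (≡.subst (P a j) (≡.sym (insertAt-lookup _ j 0#)) (Pj a))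
    (λ b → ≡.subst (P a (punchIn j b)) (≡.sym (insertAt-punchIn _ j 0# b)) (Pb a b))

  border-alternating : ∀ {n} {F : Matrix (suc n) (suc n) → Carrier} → Alternating F → ∀ j → Alternating (F ∘ border j)
  border-alternating {n} {F} F-alt j = record
    { multilinear = record
      { cong   = λ A≋B → cong λ { zero l → refl ; (suc a) l → rows-cong (A≋B a) l }
      ; linear = λ i a A≈B A≈C A≈aB+C → linear (suc i) a
          (λ { zero _ l → refl ; (suc k) k≢i → rows-cong (A≈B k (k≢i ∘ ≡.cong suc)) })
          (λ { zero _ l → refl ; (suc k) k≢i → rows-cong (A≈C k (k≢i ∘ ≡.cong suc)) })
          (rows-linear A≈aB+C) }
    ; alternating = λ i≢k A Ai≈Ak → alternating (i≢k ∘ suc-injective) (border j A) (rows-cong Ai≈Ak) }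
    where
    open Alternating F-alt
    rows-cong : ∀ {x y : Fin n → Carrier} → (∀ b → x b ≈ y b) → ∀ l → insertAt x j 0# l ≈ insertAt y j 0# l
    rows-cong x≈y = punchIn-cases _ j
      (reflexive (≡.trans (insertAt-lookup _ j 0#) (≡.sym (insertAt-lookup _ j 0#))))
      (λ b → trans (reflexive (insertAt-punchIn _ j 0# b)) (trans (x≈y b) (sym (reflexive (insertAt-punchIn _ j 0# b)))))
    rows-linear : ∀ {a} {x y z : Fin n → Carrier} → (∀ b → x b ≈ a * y b + z b) → ∀ l →
                  insertAt x j 0# l ≈ a * insertAt y j 0# l + insertAt z j 0# l
    rows-linear {a} x≈ay+z = punchIn-cases _ j
      (trans (reflexive (insertAt-lookup _ j 0#)) (sym (trans
        (+-cong (trans (*-congˡ (reflexive (insertAt-lookup _ j 0#))) (zeroʳ a)) (reflexive (insertAt-lookup _ j 0#))) (+-identityʳ 0#))))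
      (λ b → trans (reflexive (insertAt-punchIn _ j 0# b)) (trans (x≈ay+z b) (sym
        (+-cong (*-congˡ (reflexive (insertAt-punchIn _ j 0# b))) (reflexive (insertAt-punchIn _ j 0# b))))))

  -- The cycle (0 1 … j).
  toFront : ∀ {n} → Fin (suc n) → Fin (suc n) → Fin (suc n)
  toFront j zero    = j
  toFront j (suc a) = punchIn j a

  punchIn-suc-self : ∀ {n} (i : Fin n) → punchIn (suc i) i ≡ inject₁ i
  punchIn-suc-self zero    = ≡.refl
  punchIn-suc-self (suc i) = ≡.cong suc (punchIn-suc-self i)

  punchIn-inject₁-self : ∀ {n} (i : Fin n) → punchIn (inject₁ i) i ≡ suc i
  punchIn-inject₁-self zero    = ≡.refl
  punchIn-inject₁-self (suc i) = ≡.cong suc (punchIn-inject₁-self i)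

  punchIn-suc≡punchIn-inject₁ : ∀ {n} {i a : Fin n} → a ≢ i → punchIn (suc i) a ≡ punchIn (inject₁ i) a
  punchIn-suc≡punchIn-inject₁ {i = zero}  {zero}  a≢i = ⊥-elim (a≢i ≡.refl)
  punchIn-suc≡punchIn-inject₁ {i = zero}  {suc a} a≢i = ≡.refl
  punchIn-suc≡punchIn-inject₁ {i = suc i} {zero}  a≢i = ≡.refl
  punchIn-suc≡punchIn-inject₁ {i = suc i} {suc a} a≢i = ≡.cong suc (punchIn-suc≡punchIn-inject₁ (a≢i ∘ ≡.cong suc))

  -- The arrangements for `inject₁ i` and `suc i` differ by exchanging rows `zero` and `suc i`, so
  -- each induction step costs one sign.
  toFront-sign : ∀ {n} {F : Matrix (suc n) (suc n) → Carrier} → Alternating F → ∀ j →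
                 F (I ∘ toFront j) ≈ sign (toℕ j) * F I
  toFront-sign {n} {F} F-alt = <-weakInduction _
    (trans (cong λ { zero j → refl ; (suc a) j → refl }) (sym (*-identityˡ _)))
    λ i IH → begin
      F (I ∘ toFront (suc i))
        ≈⟨ swap-rows multilinear {zero} {suc i} (λ ()) (alternating λ ())
             (λ j → reflexive (≡.cong (λ k → I k j) (≡.sym (punchIn-inject₁-self i))))
             (λ j → reflexive (≡.cong (λ k → I k j) (punchIn-suc-self i)))
             (λ { zero l≢0 _ j → ⊥-elim (l≢0 ≡.refl)
                ; (suc a) _ l≢i j → reflexive (≡.cong (λ k → I k j) (punchIn-suc≡punchIn-inject₁ (l≢i ∘ ≡.cong suc))) }) ⟩
      - F (I ∘ toFront (inject₁ i))
        ≈⟨ -‿cong IH ⟩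
      - (sign (toℕ (inject₁ i)) * F I)
        ≡⟨ ≡.cong (λ m → - (sign m * F I)) (toℕ-inject₁ i) ⟩
      - (sign (toℕ i) * F I)
        ≈⟨ -1*x≈-x _ ⟨
      - 1# * (sign (toℕ i) * F I)
        ≈⟨ *-assoc _ _ _ ⟨
      sign (toℕ (suc i)) * F I ∎
    where open Alternating F-alt

  border-I : ∀ {n} (j : Fin (suc n)) → border j I ≋ I ∘ toFront j
  border-I j zero    l = refl
  border-I j (suc a) l = border-cases j I (λ a l x → x ≈ I (punchIn j a) l)
    (λ a → sym (I-off (punchInᵢ≢i j a))) punchIn-I a l
    where
    punchIn-I : ∀ a b → I a b ≈ I (punchIn j a) (punchIn j b)
    punchIn-I a b with a ≟ b
    ... | yes ≡.refl = trans (I-diag a) (sym (I-diag (punchIn j a)))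
    ... | no  a≢b    = trans (I-off a≢b) (sym (I-off (a≢b ∘ punchIn-injective j a b)))

  -- `F` satisfies the recursion that defines `Det`: resolve the first row into unit vectors, clear
  -- the column of each pivot, and apply the induction hypothesis to the form that remains in the
  -- minor. Bringing the pivot in column `j` back to the diagonal produces `sign (toℕ j)`.
  Det-unique : ∀ {n} {F : Matrix n n → Carrier} → Alternating F → ∀ A → F A ≈ Det A * F I
  Det-unique {zero}  {F} F-alt A = begin
    F A         ≈⟨ Alternating.cong F-alt (λ ()) ⟩
    F I         ≈⟨ *-identityˡ _ ⟨
    1# * F I    ≡⟨ ≡.cong (_* F I) (Det-zero A) ⟨
    Det A * F I ∎
  Det-unique {suc n} {F} F-alt A = begin
    F A
      ≈⟨ cong (λ { zero j → sym (∑-Iʳ j (A zero)) ; (suc a) j → refl }) ⟩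
    F (cons (λ j → ∑ (λ k → A zero k * I k j)) (A ∘ suc))
      ≈⟨ linear-combination multilinear (A zero) I (A ∘ suc) ⟩
    ∑ (λ j → A zero j * F (cons (I j) (A ∘ suc)))
      ≈⟨ ∑-cong (λ j → *-congˡ (begin
           F (cons (I j) (A ∘ suc))                    ≈⟨ clear-column F-alt j (A ∘ suc) ⟩
           F (border j (minor j A))                    ≈⟨ Det-unique (border-alternating F-alt j) (minor j A) ⟩
           Det (minor j A) * F (border j I)            ≈⟨ *-congˡ (cong (border-I j)) ⟩
           Det (minor j A) * F (I ∘ toFront j)         ≈⟨ *-congˡ (toFront-sign F-alt j) ⟩
           Det (minor j A) * (sign (toℕ j) * F I)      ∎)) ⟩
    ∑ (λ j → A zero j * (Det (minor j A) * (sign (toℕ j) * F I)))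
      ≈⟨ ∑-cong (λ j → rearrange _ _ _ _) ⟩
    ∑ (λ j → sign (toℕ j) * (A zero j * Det (minor j A)) * F I)
      ≈⟨ ∑-*ʳ _ _ ⟨
    ∑ (λ j → sign (toℕ j) * (A zero j * Det (minor j A))) * F I
      ≡⟨ ≡.cong (_* F I) (Det-suc A) ⟨
    Det A * F I ∎
    where
    open Alternating F-alt
    rearrange : ∀ a d s f → a * (d * (s * f)) ≈ s * (a * d) * f
    rearrange = solve 4 (λ a d s f → (a :* (d :* (s :* f))) := (s :* (a :* d) :* f)) refl

  -- Row `i` of `A · B` depends linearly on row `i` of `A` and on no other row of `A`, so uniqueness
  -- applies to the form `Det (A · B)` in `A`, whose value at `I` is `Det B`.
  Det-· : ∀ {n} (A B : Matrix n n) → Det (A · B) ≈ Det A * Det B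
  Det-· {n} A B = trans (Det-unique F-alt A) (*-congˡ (Det-cong (λ i j → ∑-Iˡ i (λ k → B k j))))
    where
    F-alt : Alternating (λ A → Det (A · B))
    F-alt = record
      { multilinear = record
        { cong   = λ A≋A′ → Det-cong λ i j → ∑-cong λ k → *-congʳ (A≋A′ i k)
        ; linear = λ i a {A} {C} {D} A≈C A≈D A≈aC+D → Multilinear.linear Det-multilinear i a
            (λ l l≢i j → ∑-cong λ k → *-congʳ (A≈C l l≢i k))
            (λ l l≢i j → ∑-cong λ k → *-congʳ (A≈D l l≢i k))
            (λ j → begin
              ∑ (λ k → A i k * B k j)
                ≈⟨ ∑-cong (λ k → trans (*-congʳ (A≈aC+D k)) (trans (distribʳ _ _ _) (+-congʳ (*-assoc _ _ _)))) ⟩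
              ∑ (λ k → a * (C i k * B k j) + D i k * B k j)
                ≈⟨ ∑-+ _ _ ⟩
              ∑ (λ k → a * (C i k * B k j)) + ∑ (λ k → D i k * B k j)
                ≈⟨ +-congʳ (∑-*ˡ a _) ⟨
              a * (C · B) i j + (D · B) i j ∎) }
      ; alternating = λ i≢k A Ai≈Ak → Det-alternating i≢k (A · B) (λ j → ∑-cong λ l → *-congʳ (Ai≈Ak l)) }

  Det-I : ∀ {n} → Det (I {n}) ≈ 1#
  Det-I {zero}  = reflexive (Det-zero I)
  Det-I {suc n} = begin
    Det (I {suc n})
      ≡⟨ Det-suc I ⟩
    ∑ (λ j → sign (toℕ j) * (I zero j * Det (minor j I)))
      ≈⟨ ∑-single _ zero (λ { zero 0≢0 → ⊥-elim (0≢0 ≡.refl)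
                            ; (suc j) _ → trans (*-congˡ (zeroˡ _)) (zeroʳ _) }) ⟩
    1# * (1# * Det (I {n}))
      ≈⟨ trans (*-identityˡ _) (*-identityˡ _) ⟩
    Det (I {n})
      ≈⟨ Det-I ⟩
    1# ∎

  -- Conjugation is stated as an intertwining relation, so no triple product arises;
  -- `Det Q * Det P ≈ 1#` is then cancelled by commutativity of `R`.
  Det-similar : ∀ {n} {A B P Q : Matrix n n} → Q · P ≋ I → A · P ≋ P · B → Det A ≈ Det B
  Det-similar {A = A} {B} {P} {Q} QP≋I AP≋PB = begin
    Det A                     ≈⟨ *-identityʳ _ ⟨
    Det A * 1#                ≈⟨ *-congˡ QP≈1 ⟨
    Det A * (Det Q * Det P)   ≈⟨ rearrange (Det A) (Det Q) (Det P) ⟩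
    Det Q * (Det A * Det P)   ≈⟨ *-congˡ (trans (sym (Det-· A P)) (trans (Det-cong AP≋PB) (Det-· P B))) ⟩
    Det Q * (Det P * Det B)   ≈⟨ *-assoc _ _ _ ⟨
    Det Q * Det P * Det B     ≈⟨ *-congʳ QP≈1 ⟩
    1# * Det B                ≈⟨ *-identityˡ _ ⟩
    Det B                     ∎
    where
    QP≈1 : Det Q * Det P ≈ 1#
    QP≈1 = trans (sym (Det-· Q P)) (trans (Det-cong QP≋I) Det-I)
    rearrange : ∀ a q p → a * (q * p) ≈ q * (a * p)
    rearrange = solve 3 (λ a q p → (a :* (q :* p)) := (q :* (a :* p))) refl

  -- Permuting rows and columns together is conjugation by the permutation matrix `P`, so no sign
  -- appears. The sizes are kept apart because they will be the lengths of two different lists.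
  Det-reindex : ∀ {m n} (π : Permutation m n) (A : Matrix n n) →
                Det (λ i j → A (π ⟨$⟩ʳ i) (π ⟨$⟩ʳ j)) ≈ Det A
  Det-reindex {m} {n} π A with ↔⇒≡ π
  ... | ≡.refl = Det-similar {P = P} {λ i j → I (π ⟨$⟩ˡ i) j}
    (λ i j → trans (∑-Iˡ _ _) (reflexive (≡.cong (λ k → I k j) (inverseʳ π))))
    (λ i j → begin
      ∑ (λ k → A (π ⟨$⟩ʳ i) (π ⟨$⟩ʳ k) * I (π ⟨$⟩ʳ k) j)
        ≈⟨ ∑-single _ (π ⟨$⟩ˡ j) (λ k k≢ → trans (*-congˡ (I-off λ πk≡j →
             k≢ (≡.trans (≡.sym (inverseˡ π)) (≡.cong (π ⟨$⟩ˡ_) πk≡j)))) (zeroʳ _)) ⟩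
      A (π ⟨$⟩ʳ i) (π ⟨$⟩ʳ (π ⟨$⟩ˡ j)) * I (π ⟨$⟩ʳ (π ⟨$⟩ˡ j)) j
        ≡⟨ ≡.cong (λ k → A (π ⟨$⟩ʳ i) k * I k j) (inverseʳ π) ⟩
      A (π ⟨$⟩ʳ i) j * I j j
        ≈⟨ trans (*-congˡ (I-diag j)) (*-identityʳ _) ⟩
      A (π ⟨$⟩ʳ i) j
        ≈⟨ ∑-Iˡ (π ⟨$⟩ʳ i) (λ k → A k j) ⟨
      ∑ (λ k → I (π ⟨$⟩ʳ i) k * A k j) ∎)
    where
    P : Matrix m m
    P i j = I (π ⟨$⟩ʳ i) j

  -- Block matrices.

  punchIn-↑ˡ : ∀ {m} n (j : Fin (suc m)) b → punchIn (j ↑ˡ n) (b ↑ˡ n) ≡ punchIn j b ↑ˡ n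
  punchIn-↑ˡ n zero    b       = ≡.refl
  punchIn-↑ˡ n (suc j) zero    = ≡.refl
  punchIn-↑ˡ n (suc j) (suc b) = ≡.cong suc (punchIn-↑ˡ n j b)

  punchIn-↑ʳ : ∀ {m n} (j : Fin (suc m)) (b : Fin n) → punchIn (j ↑ˡ n) (m ↑ʳ b) ≡ suc m ↑ʳ b
  punchIn-↑ʳ         zero    b = ≡.refl
  punchIn-↑ʳ {suc m} (suc j) b = ≡.cong suc (punchIn-↑ʳ j b)

  -- As the upper right block is zero, the first-row expansion runs over the left columns only; each
  -- minor has the same shape with `m` lowered by one and the lower right block unchanged.
  Det-block-triangular : ∀ m {n} (A : Matrix (m ℕ.+ n) (m ℕ.+ n)) → (∀ i j → A (i ↑ˡ n) (m ↑ʳ j) ≈ 0#) →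
    Det A ≈ Det {m} (λ i j → A (i ↑ˡ n) (j ↑ˡ n)) * Det {n} (λ i j → A (m ↑ʳ i) (m ↑ʳ j))
  Det-block-triangular zero    A A≈0 = sym (trans (*-congʳ (reflexive (Det-zero _))) (*-identityˡ _))
  Det-block-triangular (suc m) {n} A A≈0 = begin
    Det A
      ≡⟨ Det-suc A ⟩
    ∑ (λ j → sign (toℕ j) * (A zero j * Det (minor j A)))
      ≈⟨ ∑-split (suc m) _ ⟩
    ∑ {suc m} (λ j → sign (toℕ (j ↑ˡ n)) * (A zero (j ↑ˡ n) * Det (minor (j ↑ˡ n) A))) +
      ∑ {n} (λ j → sign (toℕ (suc m ↑ʳ j)) * (A zero (suc m ↑ʳ j) * Det (minor (suc m ↑ʳ j) A)))
      ≈⟨ trans (+-congˡ (∑-zero (λ j → trans (*-congˡ (trans (*-congʳ (A≈0 zero j)) (zeroˡ _))) (zeroʳ _)))) (+-identityʳ _) ⟩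
    ∑ {suc m} (λ j → sign (toℕ (j ↑ˡ n)) * (A zero (j ↑ˡ n) * Det (minor (j ↑ˡ n) A)))
      ≈⟨ ∑-cong (λ j → *-cong (reflexive (≡.cong sign (toℕ-↑ˡ j n))) (*-congˡ (trans
           (Det-block-triangular m (minor (j ↑ˡ n) A) (λ a b →
             trans (reflexive (≡.cong (A (suc a ↑ˡ n)) (punchIn-↑ʳ j b))) (A≈0 (suc a) b)))
           (*-cong (Det-cong λ a b → reflexive (≡.cong (A (suc a ↑ˡ n)) (punchIn-↑ˡ n j b)))
                   (Det-cong λ a b → reflexive (≡.cong (A (suc m ↑ʳ a)) (punchIn-↑ʳ j b))))))) ⟩
    ∑ {suc m} (λ j → sign (toℕ j) * (topLeft zero j * (Det (minor j topLeft) * Det bottomRight)))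
      ≈⟨ ∑-cong (λ j → trans (*-congˡ (sym (*-assoc _ _ _))) (sym (*-assoc _ _ _))) ⟩
    ∑ {suc m} (λ j → sign (toℕ j) * (topLeft zero j * Det (minor j topLeft)) * Det bottomRight)
      ≈⟨ ∑-*ʳ _ _ ⟨
    ∑ {suc m} (λ j → sign (toℕ j) * (topLeft zero j * Det (minor j topLeft))) * Det bottomRight
      ≡⟨ ≡.cong (_* Det bottomRight) (Det-suc topLeft) ⟨
    Det topLeft * Det bottomRight ∎
    where
    topLeft : Matrix (suc m) (suc m)
    topLeft i j = A (i ↑ˡ n) (j ↑ˡ n)
    bottomRight : Matrix n n
    bottomRight i j = A (suc m ↑ʳ i) (suc m ↑ʳ j)

  infixl 6 _⊞_
  _⊞_ : ∀ {m n} → Matrix m n → Matrix m n → Matrix m n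
  (A ⊞ B) i j = A i j + B i j

  ⊟_ : ∀ {m n} → Matrix m n → Matrix m n
  (⊟ A) i j = - A i j

  O : ∀ {m n} → Matrix m n
  O i j = 0#

  ↑-cases : ∀ {p m n} (P : Fin (m ℕ.+ n) → Set p) → (∀ i → P (i ↑ˡ n)) → (∀ j → P (m ↑ʳ j)) → ∀ k → P k
  ↑-cases {m = m} {n} P left right k = ≡.subst P (join-splitAt m n k) (helper (splitAt m k))
    where
    helper : ∀ s → P (join m n s)
    helper (inj₁ i) = left i
    helper (inj₂ j) = right j

  block : ∀ {m n} → Matrix m m → Matrix m n → Matrix n m → Matrix n n → Matrix (m ℕ.+ n) (m ℕ.+ n)
  block {m} A B C D i j =
    [ (λ i → [ A i , B i ] (splitAt m j)) , (λ i → [ C i , D i ] (splitAt m j)) ] (splitAt m i)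

  module _ {m n} (A : Matrix m m) (B : Matrix m n) (C : Matrix n m) (D : Matrix n n) where
    block₁₁ : ∀ i j → block A B C D (i ↑ˡ n) (j ↑ˡ n) ≡ A i j
    block₁₁ i j rewrite splitAt-↑ˡ m i n | splitAt-↑ˡ m j n = ≡.refl
    block₁₂ : ∀ i j → block A B C D (i ↑ˡ n) (m ↑ʳ j) ≡ B i j
    block₁₂ i j rewrite splitAt-↑ˡ m i n | splitAt-↑ʳ m n j = ≡.refl
    block₂₁ : ∀ i j → block A B C D (m ↑ʳ i) (j ↑ˡ n) ≡ C i j
    block₂₁ i j rewrite splitAt-↑ʳ m n i | splitAt-↑ˡ m j n = ≡.refl
    block₂₂ : ∀ i j → block A B C D (m ↑ʳ i) (m ↑ʳ j) ≡ D i j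
    block₂₂ i j rewrite splitAt-↑ʳ m n i | splitAt-↑ʳ m n j = ≡.refl

    ≋-block : ∀ {M} → (∀ i j → M (i ↑ˡ n) (j ↑ˡ n) ≈ A i j) → (∀ i j → M (i ↑ˡ n) (m ↑ʳ j) ≈ B i j) →
              (∀ i j → M (m ↑ʳ i) (j ↑ˡ n) ≈ C i j) → (∀ i j → M (m ↑ʳ i) (m ↑ʳ j) ≈ D i j) → M ≋ block A B C D
    ≋-block M₁₁ M₁₂ M₂₁ M₂₂ = ↑-cases _
      (λ i → ↑-cases _ (λ j → trans (M₁₁ i j) (reflexive (≡.sym (block₁₁ i j))))
                       (λ j → trans (M₁₂ i j) (reflexive (≡.sym (block₁₂ i j)))))
      (λ i → ↑-cases _ (λ j → trans (M₂₁ i j) (reflexive (≡.sym (block₂₁ i j))))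
                       (λ j → trans (M₂₂ i j) (reflexive (≡.sym (block₂₂ i j)))))

    Det-block-lower : B ≋ O → Det (block A B C D) ≈ Det A * Det D
    Det-block-lower B≋O = trans
      (Det-block-triangular m (block A B C D) (λ i j → trans (reflexive (block₁₂ i j)) (B≋O i j)))
      (*-cong (Det-cong λ i j → reflexive (block₁₁ i j)) (Det-cong λ i j → reflexive (block₂₂ i j)))

  block-cong : ∀ {m n} {A A′ : Matrix m m} {B B′ : Matrix m n} {C C′ : Matrix n m} {D D′ : Matrix n n} →
               A ≋ A′ → B ≋ B′ → C ≋ C′ → D ≋ D′ → block A B C D ≋ block A′ B′ C′ D′
  block-cong {A = A} {A′} {B} {B′} {C} {C′} {D} {D′} A≋ B≋ C≋ D≋ = ≋-block A′ B′ C′ D′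
    (λ i j → trans (reflexive (block₁₁ A B C D i j)) (A≋ i j))
    (λ i j → trans (reflexive (block₁₂ A B C D i j)) (B≋ i j))
    (λ i j → trans (reflexive (block₂₁ A B C D i j)) (C≋ i j))
    (λ i j → trans (reflexive (block₂₂ A B C D i j)) (D≋ i j))

  block-· : ∀ {m n} (A A′ : Matrix m m) (B B′ : Matrix m n) (C C′ : Matrix n m) (D D′ : Matrix n n) →
            block A B C D · block A′ B′ C′ D′ ≋
            block (A · A′ ⊞ B · C′) (A · B′ ⊞ B · D′) (C · A′ ⊞ D · C′) (C · B′ ⊞ D · D′)
  block-· {m} A A′ B B′ C C′ D D′ = ≋-block _ _ _ _
    (λ i j → entry (λ k → block₁₁ A B C D i k) (λ k → block₁₁ A′ B′ C′ D′ k j) (λ k → block₁₂ A B C D i k) (λ k → block₂₁ A′ B′ C′ D′ k j))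
    (λ i j → entry (λ k → block₁₁ A B C D i k) (λ k → block₁₂ A′ B′ C′ D′ k j) (λ k → block₁₂ A B C D i k) (λ k → block₂₂ A′ B′ C′ D′ k j))
    (λ i j → entry (λ k → block₂₁ A B C D i k) (λ k → block₁₁ A′ B′ C′ D′ k j) (λ k → block₂₂ A B C D i k) (λ k → block₂₁ A′ B′ C′ D′ k j))
    (λ i j → entry (λ k → block₂₁ A B C D i k) (λ k → block₁₂ A′ B′ C′ D′ k j) (λ k → block₂₂ A B C D i k) (λ k → block₂₂ A′ B′ C′ D′ k j))
    where
    entry : ∀ {m n} {f g : Fin (m ℕ.+ n) → Carrier} {f₁ g₁ : Fin m → Carrier} {f₂ g₂ : Fin n → Carrier} →
            (∀ k → f (k ↑ˡ n) ≡ f₁ k) → (∀ k → g (k ↑ˡ n) ≡ g₁ k) →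
            (∀ k → f (m ↑ʳ k) ≡ f₂ k) → (∀ k → g (m ↑ʳ k) ≡ g₂ k) →
            ∑ (λ k → f k * g k) ≈ ∑ (λ k → f₁ k * g₁ k) + ∑ (λ k → f₂ k * g₂ k)
    entry {m} f₁≡ g₁≡ f₂≡ g₂≡ = trans (∑-split m _)
      (+-cong (∑-cong λ k → *-cong (reflexive (f₁≡ k)) (reflexive (g₁≡ k)))
              (∑-cong λ k → *-cong (reflexive (f₂≡ k)) (reflexive (g₂≡ k))))

  I≋block : ∀ {m n} → I ≋ block {m} {n} I O O I
  I≋block {m} {n} = ≋-block I O O I (I-↑ (_↑ˡ n) (↑ˡ-injective n _ _)) (λ i j → I-off (↑ˡ≢↑ʳ i j))
    (λ i j → I-off (λ i≡j → ↑ˡ≢↑ʳ j i (≡.sym i≡j))) (I-↑ (m ↑ʳ_) (↑ʳ-injective m _ _))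
    where
    I-↑ : ∀ {k l} (f : Fin k → Fin l) → (∀ {i j} → f i ≡ f j → i ≡ j) → ∀ i j → I (f i) (f j) ≈ I i j
    I-↑ f f-injective i j with i ≟ j
    ... | yes ≡.refl = trans (I-diag (f i)) (sym (I-diag i))
    ... | no  i≢j    = trans (I-off (i≢j ∘ f-injective)) (sym (I-off i≢j))
    ↑ˡ≢↑ʳ : ∀ {m n} (i : Fin m) (j : Fin n) → i ↑ˡ n ≢ m ↑ʳ j
    ↑ˡ≢↑ʳ zero    j ()
    ↑ˡ≢↑ʳ (suc i) j i≡j = ↑ˡ≢↑ʳ i j (suc-injective i≡j)

  -- Characteristic matrices of the two products, up to a power of the parameter.

  infixl 6 _⊝_
  _⊝_ : ∀ {n} → Carrier → Matrix n n → Matrix n n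
  (a ⊝ A) i j = a * I i j - A i j

  Det-1 : ∀ (A : Matrix 1 1) → Det A ≈ A zero zero
  Det-1 A = begin
    Det A
      ≡⟨ Det-suc A ⟩
    ∑ (λ j → sign (toℕ j) * (A zero j * Det (minor j A)))
      ≈⟨ ∑-single _ zero (λ { zero 0≢0 → ⊥-elim (0≢0 ≡.refl) ; (suc ()) }) ⟩
    1# * (A zero zero * Det (minor zero A))
      ≈⟨ trans (*-identityˡ _) (trans (*-congˡ (reflexive (Det-zero _))) (*-identityʳ _)) ⟩
    A zero zero ∎

  Det-scalar : ∀ {n} a → Det {n} (λ i j → a * I i j) ≈ pow R a n
  Det-scalar {zero}  a = reflexive (Det-zero _)
  Det-scalar {suc n} a = begin
    Det {suc n} (λ i j → a * I i j)
      ≈⟨ Det-block-triangular 1 {n} _ (λ { zero j → zeroʳ a }) ⟩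
    Det {1} (λ i j → a * I (i ↑ˡ n) (j ↑ˡ n)) * Det {n} (λ i j → a * I i j)
      ≈⟨ *-cong (Det-1 _) (Det-scalar a) ⟩
    a * 1# * pow R a n
      ≈⟨ *-congʳ (*-identityʳ a) ⟩
    a * pow R a n ∎
  -- (a − UV  0 ; −V  a) is conjugate to (a  0 ; −V  a − VU) by (1  U ; 0  1).
  Det-⊝-comm-scaled : ∀ {n} a (U V : Matrix n n) →
                      Det (a ⊝ U · V) * pow R a n ≈ pow R a n * Det (a ⊝ V · U)
  Det-⊝-comm-scaled {n} a U V = begin
    Det (a ⊝ U · V) * pow R a n
      ≈⟨ *-congˡ (Det-scalar a) ⟨
    Det (a ⊝ U · V) * Det {n} aI
      ≈⟨ Det-block-lower (a ⊝ U · V) O (⊟ V) aI (λ i j → refl) ⟨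
    Det (block (a ⊝ U · V) O (⊟ V) aI)
      ≈⟨ Det-similar {P = block I U O I} {block I (⊟ U) O I} inverse conjugate ⟩
    Det (block aI O (⊟ V) (a ⊝ V · U))
      ≈⟨ Det-block-lower aI O (⊟ V) (a ⊝ V · U) (λ i j → refl) ⟩
    Det {n} aI * Det (a ⊝ V · U)
      ≈⟨ *-congʳ (Det-scalar a) ⟩
    pow R a n * Det (a ⊝ V · U) ∎
    where
    aI : Matrix n n
    aI i j = a * I i j

    O·ˡ : ∀ (A : Matrix n n) i j → (O · A) i j ≈ 0#
    O·ˡ A i j = ∑-zero λ k → zeroˡ (A k j)

    O·ʳ : ∀ (A : Matrix n n) i j → (A · O) i j ≈ 0#
    O·ʳ A i j = ∑-zero λ k → zeroʳ (A i k)

    ·I : ∀ (A : Matrix n n) i j → (A · I) i j ≈ A i j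
    ·I A i j = ∑-Iʳ j (A i)

    I· : ∀ (A : Matrix n n) i j → (I · A) i j ≈ A i j
    I· A i j = ∑-Iˡ i (λ k → A k j)

    +0 : ∀ {x y z} → x ≈ z → y ≈ 0# → x + y ≈ z
    +0 x≈z y≈0 = trans (+-cong x≈z y≈0) (+-identityʳ _)

    0+ : ∀ {x y z} → x ≈ 0# → y ≈ z → x + y ≈ z
    0+ x≈0 y≈z = trans (+-cong x≈0 y≈z) (+-identityˡ _)

    inverse : block I (⊟ U) O I · block I U O I ≋ I
    inverse i j = trans (block-· I I (⊟ U) U O O I I i j) (sym (trans (I≋block {n} {n} i j) (block-cong {A = I} {B = O} {C = O} {D = I}
      (λ i j → sym (+0 (I· I i j) (O·ʳ (⊟ U) i j)))
      (λ i j → sym (trans (+-cong (I· U i j) (·I (⊟ U) i j)) (-‿inverseʳ _)))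
      (λ i j → sym (+0 (O·ˡ I i j) (O·ʳ I i j)))
      (λ i j → sym (0+ (O·ˡ U i j) (I· I i j))) i j)))

    neg-· : ∀ (A B : Matrix n n) i j → ((⊟ A) · B) i j ≈ - (A · B) i j
    neg-· A B i j = begin
      ∑ (λ k → - A i k * B k j)
        ≈⟨ ∑-cong (λ k → trans (sym (-‿distribˡ-* _ _)) (sym (-1*x≈-x _))) ⟩
      ∑ (λ k → - 1# * (A i k * B k j))
        ≈⟨ ∑-*ˡ _ _ ⟨
      - 1# * (A · B) i j
        ≈⟨ -1*x≈-x _ ⟩
      - (A · B) i j ∎

    ·-neg : ∀ (A B : Matrix n n) i j → (A · (⊟ B)) i j ≈ - (A · B) i j
    ·-neg A B i j = begin
      ∑ (λ k → A i k * - B k j)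
        ≈⟨ ∑-cong (λ k → trans (sym (-‿distribʳ-* _ _)) (sym (-1*x≈-x _))) ⟩
      ∑ (λ k → - 1# * (A i k * B k j))
        ≈⟨ ∑-*ˡ _ _ ⟨
      - 1# * (A · B) i j
        ≈⟨ -1*x≈-x _ ⟩
      - (A · B) i j ∎

    aI· : ∀ (A : Matrix n n) i j → (aI · A) i j ≈ a * A i j
    aI· A i j = trans (∑-cong (λ k → *-assoc a (I i k) (A k j))) (trans (sym (∑-*ˡ a _)) (*-congˡ (I· A i j)))

    ·aI : ∀ (A : Matrix n n) i j → (A · aI) i j ≈ a * A i j
    ·aI A i j = trans (∑-cong (λ k → swap (A i k) a (I k j))) (trans (sym (∑-*ˡ a _)) (*-congˡ (·I A i j)))
      where
      swap : ∀ x y z → x * (y * z) ≈ y * (x * z)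
      swap = solve 3 (λ x y z → (x :* (y :* z)) := (y :* (x :* z))) refl

    -- Both sides are `a U - U V U`. This is the upper right block of `conjugate`.
    intertwine : (a ⊝ U · V) · U ≋ U · (a ⊝ V · U)
    intertwine i j = begin
      ∑ (λ k → (a * I i k - (U · V) i k) * U k j)
        ≈⟨ trans (∑-cong (λ k → distribʳ _ _ _)) (∑-+ _ _) ⟩
      (aI · U) i j + ((⊟ (U · V)) · U) i j
        ≈⟨ +-cong (trans (aI· U i j) (sym (·aI U i j))) (trans (neg-· (U · V) U i j)
             (trans (-‿cong (·-assoc U V U i j)) (sym (·-neg U (V · U) i j)))) ⟩
      (U · aI) i j + (U · (⊟ (V · U))) i j
        ≈⟨ trans (∑-cong (λ k → distribˡ _ _ _)) (∑-+ _ _) ⟨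
      ∑ (λ k → U i k * (a * I k j - (V · U) k j)) ∎

    conjugate : block (a ⊝ U · V) O (⊟ V) aI · block I U O I ≋ block I U O I · block aI O (⊟ V) (a ⊝ V · U)
    conjugate i j = trans (block-· (a ⊝ U · V) I O U (⊟ V) O aI I i j)
      (trans (block-cong
        (λ i j → trans (+0 (·I (a ⊝ U · V) i j) (O·ʳ O i j)) (sym (+-cong (I· aI i j) (·-neg U V i j))))
        (λ i j → trans (+0 (intertwine i j) (O·ˡ I i j)) (sym (0+ (O·ʳ I i j) refl)))
        (λ i j → trans (+0 (·I (⊟ V) i j) (O·ʳ aI i j)) (sym (0+ (O·ˡ aI i j) (I· (⊟ V) i j))))
        (λ i j → trans (trans (+-cong (neg-· V U i j) (·I aI i j)) (+-comm _ _)) (sym (0+ (O·ʳ O i j) (I· (a ⊝ V · U) i j)))) i j)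
      (sym (block-· I aI U O O (⊟ V) I (a ⊝ V · U) i j)))

-- The polynomial ring over `R`, cancellation of X, and evaluation.

module Polynomials {c ℓ : Level} (R : CommutativeRing c ℓ) where
  open CommutativeRing R hiding (zero)
  open import Algebra.Properties.Ring ring using (-0#≈0#; -‿distribʳ-*; -‿+-comm)
  open import Relation.Binary.Reasoning.Setoid setoid
  open import Algebra.Solver.Ring.NaturalCoefficients.Default commutativeSemiring using (solve; _:+_; _:*_; _:=_)

  Polynomial : Set c
  Polynomial = List Carrier

  coeff : Polynomial → ℕ → Carrier
  coeff []      n       = 0#
  coeff (a ∷ p) zero    = a
  coeff (a ∷ p) (suc n) = coeff p n

  -- Trailing zeros are not significant.
  infix 4 _≈ᴾ_
  record _≈ᴾ_ (p q : Polynomial) : Set ℓ where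
    constructor coeffwise
    field coeff-≈ : ∀ n → coeff p n ≈ coeff q n
  open _≈ᴾ_

  infixl 6 _+ᴾ_
  _+ᴾ_ : Polynomial → Polynomial → Polynomial
  []      +ᴾ q       = q
  (a ∷ p) +ᴾ []      = a ∷ p
  (a ∷ p) +ᴾ (b ∷ q) = (a + b) ∷ (p +ᴾ q)

  scale : Carrier → Polynomial → Polynomial
  scale a = map (a *_)

  infixl 7 _*ᴾ_
  _*ᴾ_ : Polynomial → Polynomial → Polynomial
  []      *ᴾ q = []
  (a ∷ p) *ᴾ q = scale a q +ᴾ (0# ∷ (p *ᴾ q))

  -ᴾ_ : Polynomial → Polynomial
  -ᴾ_ = map (λ a → - a)

  coeff-+ : ∀ p q n → coeff (p +ᴾ q) n ≈ coeff p n + coeff q n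
  coeff-+ []      q       n       = sym (+-identityˡ _)
  coeff-+ (a ∷ p) []      n       = sym (+-identityʳ _)
  coeff-+ (a ∷ p) (b ∷ q) zero    = refl
  coeff-+ (a ∷ p) (b ∷ q) (suc n) = coeff-+ p q n

  coeff-scale : ∀ a p n → coeff (scale a p) n ≈ a * coeff p n
  coeff-scale a []      n       = sym (zeroʳ a)
  coeff-scale a (b ∷ p) zero    = refl
  coeff-scale a (b ∷ p) (suc n) = coeff-scale a p n

  coeff-neg : ∀ p n → coeff (-ᴾ p) n ≈ - coeff p n
  coeff-neg []      n       = sym -0#≈0#
  coeff-neg (a ∷ p) zero    = refl
  coeff-neg (a ∷ p) (suc n) = coeff-neg p n

  -- The Cauchy product of coefficient sequences. The ring laws of polynomials are proved here, on
  -- infinite sequences, where lists of different lengths cause no case distinctions.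
  conv : (ℕ → Carrier) → (ℕ → Carrier) → ℕ → Carrier
  conv f g zero    = f 0 * g 0
  conv f g (suc n) = f 0 * g (suc n) + conv (f ∘ suc) g n

  conv-cong : ∀ {f f′ g g′} → (∀ n → f n ≈ f′ n) → (∀ n → g n ≈ g′ n) → ∀ n → conv f g n ≈ conv f′ g′ n
  conv-cong f≈ g≈ zero    = *-cong (f≈ 0) (g≈ 0)
  conv-cong f≈ g≈ (suc n) = +-cong (*-cong (f≈ 0) (g≈ (suc n))) (conv-cong (f≈ ∘ suc) g≈ n)

  conv-0ˡ : ∀ g n → conv (λ _ → 0#) g n ≈ 0#
  conv-0ˡ g zero    = zeroˡ _
  conv-0ˡ g (suc n) = trans (+-cong (zeroˡ _) (conv-0ˡ g n)) (+-identityʳ _)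

  -- The recursion of `conv` splits off the term with `f 0`; splitting off the term with `g 0`
  -- instead lets commutativity go by induction.
  conv-peel : ∀ f g n → conv f g (suc n) ≈ conv f (g ∘ suc) n + f (suc n) * g 0
  conv-peel f g zero    = refl
  conv-peel f g (suc n) = trans (+-congˡ (conv-peel (f ∘ suc) g n)) (sym (+-assoc _ _ _))

  conv-comm : ∀ f g n → conv f g n ≈ conv g f n
  conv-comm f g zero    = *-comm _ _
  conv-comm f g (suc n) = begin
    f 0 * g (suc n) + conv (f ∘ suc) g n     ≈⟨ +-cong (*-comm _ _) (conv-comm (f ∘ suc) g n) ⟩
    g (suc n) * f 0 + conv g (f ∘ suc) n     ≈⟨ +-comm _ _ ⟩
    conv g (f ∘ suc) n + g (suc n) * f 0     ≈⟨ conv-peel g f n ⟨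
    conv g f (suc n)                         ∎

  conv-+ˡ : ∀ f g h n → conv (λ m → f m + g m) h n ≈ conv f h n + conv g h n
  conv-+ˡ f g h zero    = distribʳ _ _ _
  conv-+ˡ f g h (suc n) = trans (+-cong (distribʳ _ _ _) (conv-+ˡ (f ∘ suc) (g ∘ suc) h n))
    (solve 4 (λ a b c d → ((a :+ b) :+ (c :+ d)) := ((a :+ c) :+ (b :+ d))) refl _ _ _ _)

  conv-scaleˡ : ∀ a f g n → conv (λ m → a * f m) g n ≈ a * conv f g n
  conv-scaleˡ a f g zero    = *-assoc _ _ _
  conv-scaleˡ a f g (suc n) = trans (+-cong (*-assoc _ _ _) (conv-scaleˡ a (f ∘ suc) g n)) (sym (distribˡ _ _ _))

  conv-assoc : ∀ f g h n → conv (conv f g) h n ≈ conv f (conv g h) n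
  conv-assoc f g h zero    = *-assoc _ _ _
  conv-assoc f g h (suc n) = begin
    f 0 * g 0 * h (suc n) + conv (λ m → f 0 * g (suc m) + conv (f ∘ suc) g m) h n
      ≈⟨ +-congˡ (trans (conv-+ˡ _ _ h n) (+-cong (conv-scaleˡ (f 0) (g ∘ suc) h n) (conv-assoc (f ∘ suc) g h n))) ⟩
    f 0 * g 0 * h (suc n) + (f 0 * conv (g ∘ suc) h n + conv (f ∘ suc) (conv g h) n)
      ≈⟨ solve 5 (λ f g h x y → (f :* g :* h :+ (f :* x :+ y)) := (f :* (g :* h :+ x) :+ y)) refl _ _ _ _ _ ⟩
    f 0 * (g 0 * h (suc n) + conv (g ∘ suc) h n) + conv (f ∘ suc) (conv g h) n ∎

  coeff-* : ∀ p q n → coeff (p *ᴾ q) n ≈ conv (coeff p) (coeff q) n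
  coeff-* []      q n       = sym (conv-0ˡ (coeff q) n)
  coeff-* (a ∷ p) q zero    = trans (coeff-+ (scale a q) _ 0) (trans (+-identityʳ _) (coeff-scale a q 0))
  coeff-* (a ∷ p) q (suc n) = trans (coeff-+ (scale a q) _ (suc n)) (+-cong (coeff-scale a q (suc n)) (coeff-* p q n))

  1ᴾ X : Polynomial
  1ᴾ = 1# ∷ []
  X  = 0# ∷ 1# ∷ []

  constant : Carrier → Polynomial
  constant a = a ∷ []

  conv-1ˡ : ∀ g n → conv (coeff 1ᴾ) g n ≈ g n
  conv-1ˡ g zero    = *-identityˡ _
  conv-1ˡ g (suc n) = trans (+-cong (*-identityˡ _) (conv-0ˡ g n)) (+-identityʳ _)

  *ᴾ-comm : ∀ p q → p *ᴾ q ≈ᴾ q *ᴾ p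
  *ᴾ-comm p q = coeffwise λ n → begin
    coeff (p *ᴾ q) n            ≈⟨ coeff-* p q n ⟩
    conv (coeff p) (coeff q) n  ≈⟨ conv-comm (coeff p) (coeff q) n ⟩
    conv (coeff q) (coeff p) n  ≈⟨ coeff-* q p n ⟨
    coeff (q *ᴾ p) n            ∎

  *ᴾ-assoc : ∀ p q r → (p *ᴾ q) *ᴾ r ≈ᴾ p *ᴾ (q *ᴾ r)
  *ᴾ-assoc p q r = coeffwise λ n → begin
    coeff ((p *ᴾ q) *ᴾ r) n                        ≈⟨ coeff-* (p *ᴾ q) r n ⟩
    conv (coeff (p *ᴾ q)) (coeff r) n              ≈⟨ conv-cong (coeff-* p q) (λ _ → refl) n ⟩
    conv (conv (coeff p) (coeff q)) (coeff r) n    ≈⟨ conv-assoc (coeff p) (coeff q) (coeff r) n ⟩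
    conv (coeff p) (conv (coeff q) (coeff r)) n    ≈⟨ conv-cong (λ _ → refl) (coeff-* q r) n ⟨
    conv (coeff p) (coeff (q *ᴾ r)) n              ≈⟨ coeff-* p (q *ᴾ r) n ⟨
    coeff (p *ᴾ (q *ᴾ r)) n                        ∎

  *ᴾ-distribʳ : ∀ r p q → (p +ᴾ q) *ᴾ r ≈ᴾ (p *ᴾ r) +ᴾ (q *ᴾ r)
  *ᴾ-distribʳ r p q = coeffwise λ n → begin
    coeff ((p +ᴾ q) *ᴾ r) n                                  ≈⟨ coeff-* (p +ᴾ q) r n ⟩
    conv (coeff (p +ᴾ q)) (coeff r) n                        ≈⟨ conv-cong (coeff-+ p q) (λ _ → refl) n ⟩
    conv (λ m → coeff p m + coeff q m) (coeff r) n           ≈⟨ conv-+ˡ (coeff p) (coeff q) (coeff r) n ⟩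
    conv (coeff p) (coeff r) n + conv (coeff q) (coeff r) n  ≈⟨ +-cong (coeff-* p r n) (coeff-* q r n) ⟨
    coeff (p *ᴾ r) n + coeff (q *ᴾ r) n                      ≈⟨ coeff-+ (p *ᴾ r) (q *ᴾ r) n ⟨
    coeff ((p *ᴾ r) +ᴾ (q *ᴾ r)) n                           ∎

  +ᴾ-cong : ∀ {p p′ q q′} → p ≈ᴾ p′ → q ≈ᴾ q′ → p +ᴾ q ≈ᴾ p′ +ᴾ q′
  +ᴾ-cong {p} {p′} {q} {q′} p≈ q≈ = coeffwise λ n →
    trans (coeff-+ p q n) (trans (+-cong (coeff-≈ p≈ n) (coeff-≈ q≈ n)) (sym (coeff-+ p′ q′ n)))

  *ᴾ-cong : ∀ {p p′ q q′} → p ≈ᴾ p′ → q ≈ᴾ q′ → p *ᴾ q ≈ᴾ p′ *ᴾ q′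
  *ᴾ-cong {p} {p′} {q} {q′} p≈ q≈ = coeffwise λ n →
    trans (coeff-* p q n) (trans (conv-cong (coeff-≈ p≈) (coeff-≈ q≈) n) (sym (coeff-* p′ q′ n)))

  -ᴾ-cong : ∀ {p q} → p ≈ᴾ q → -ᴾ p ≈ᴾ -ᴾ q
  -ᴾ-cong {p} {q} p≈q = coeffwise λ n →
    trans (coeff-neg p n) (trans (-‿cong (coeff-≈ p≈q n)) (sym (coeff-neg q n)))

  +ᴾ-assoc : ∀ p q r → (p +ᴾ q) +ᴾ r ≈ᴾ p +ᴾ (q +ᴾ r)
  +ᴾ-assoc p q r = coeffwise λ n → begin
    coeff ((p +ᴾ q) +ᴾ r) n                ≈⟨ trans (coeff-+ (p +ᴾ q) r n) (+-congʳ (coeff-+ p q n)) ⟩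
    (coeff p n + coeff q n) + coeff r n    ≈⟨ +-assoc _ _ _ ⟩
    coeff p n + (coeff q n + coeff r n)    ≈⟨ trans (coeff-+ p (q +ᴾ r) n) (+-congˡ (coeff-+ q r n)) ⟨
    coeff (p +ᴾ (q +ᴾ r)) n                ∎

  +ᴾ-comm : ∀ p q → p +ᴾ q ≈ᴾ q +ᴾ p
  +ᴾ-comm p q = coeffwise λ n → trans (coeff-+ p q n) (trans (+-comm _ _) (sym (coeff-+ q p n)))

  +ᴾ-identityʳ : ∀ p → p +ᴾ [] ≈ᴾ p
  +ᴾ-identityʳ p = coeffwise λ n → trans (coeff-+ p [] n) (+-identityʳ _)

  +ᴾ-inverseʳ : ∀ p → p +ᴾ (-ᴾ p) ≈ᴾ []
  +ᴾ-inverseʳ p = coeffwise λ n → trans (coeff-+ p (-ᴾ p) n) (trans (+-congˡ (coeff-neg p n)) (-‿inverseʳ _))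

  ≈ᴾ-refl : ∀ {p} → p ≈ᴾ p
  ≈ᴾ-refl = coeffwise λ n → refl

  ≈ᴾ-sym : ∀ {p q} → p ≈ᴾ q → q ≈ᴾ p
  ≈ᴾ-sym p≈q = coeffwise λ n → sym (coeff-≈ p≈q n)

  ≈ᴾ-trans : ∀ {p q r} → p ≈ᴾ q → q ≈ᴾ r → p ≈ᴾ r
  ≈ᴾ-trans p≈q q≈r = coeffwise λ n → trans (coeff-≈ p≈q n) (coeff-≈ q≈r n)

  *ᴾ-identityˡ : ∀ p → 1ᴾ *ᴾ p ≈ᴾ p
  *ᴾ-identityˡ p = coeffwise λ n → trans (coeff-* 1ᴾ p n) (conv-1ˡ (coeff p) n)

  R[X] : CommutativeRing c ℓ
  R[X] = record
    { Carrier = Polynomial ; _≈_ = _≈ᴾ_ ; _+_ = _+ᴾ_ ; _*_ = _*ᴾ_ ; -_ = -ᴾ_ ; 0# = [] ; 1# = 1ᴾ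
    ; isCommutativeRing = record
      { isRing = record
        { +-isAbelianGroup = record
          { isGroup = record
            { isMonoid = record
              { isSemigroup = record
                { isMagma = record
                  { isEquivalence = record { refl = ≈ᴾ-refl ; sym = ≈ᴾ-sym ; trans = ≈ᴾ-trans }
                  ; ∙-cong = +ᴾ-cong }
                ; assoc = +ᴾ-assoc }
              ; identity = (λ p → ≈ᴾ-refl) , +ᴾ-identityʳ }
            ; inverse = (λ p → ≈ᴾ-trans (+ᴾ-comm (-ᴾ p) p) (+ᴾ-inverseʳ p)) , +ᴾ-inverseʳ
            ; ⁻¹-cong = -ᴾ-cong }
          ; comm = +ᴾ-comm }
        ; *-cong = *ᴾ-cong
        ; *-assoc = *ᴾ-assoc
        ; *-identity = *ᴾ-identityˡ , (λ p → ≈ᴾ-trans (*ᴾ-comm p 1ᴾ) (*ᴾ-identityˡ p))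
        ; distrib = (λ p q r → ≈ᴾ-trans (*ᴾ-comm p (q +ᴾ r)) (≈ᴾ-trans (*ᴾ-distribʳ p q r)
                      (+ᴾ-cong (*ᴾ-comm q p) (*ᴾ-comm r p)))) , *ᴾ-distribʳ }
      ; *-comm = *ᴾ-comm } }

  X-shift : ∀ p n → coeff (X *ᴾ p) (suc n) ≈ coeff p n
  X-shift p n = begin
    coeff (X *ᴾ p) (suc n)                              ≈⟨ coeff-* X p (suc n) ⟩
    0# * coeff p (suc n) + conv (coeff 1ᴾ) (coeff p) n  ≈⟨ +-cong (zeroˡ _) (conv-1ˡ (coeff p) n) ⟩
    0# + coeff p n                                      ≈⟨ +-identityˡ _ ⟩
    coeff p n                                           ∎

  -- Multiplication by `X` merely shifts the coefficients, so `X` is regular even when `R` has zero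
  -- divisors.
  X-cancelˡ : ∀ p q → X *ᴾ p ≈ᴾ X *ᴾ q → p ≈ᴾ q
  X-cancelˡ p q Xp≈Xq = coeffwise λ n →
    trans (sym (X-shift p n)) (trans (coeff-≈ Xp≈Xq (suc n)) (X-shift q n))

  X^-cancelˡ : ∀ m p q → pow R[X] X m *ᴾ p ≈ᴾ pow R[X] X m *ᴾ q → p ≈ᴾ q
  X^-cancelˡ zero    p q eq = ≈ᴾ-trans (≈ᴾ-sym (*ᴾ-identityˡ p)) (≈ᴾ-trans eq (*ᴾ-identityˡ q))
  X^-cancelˡ (suc m) p q eq = X^-cancelˡ m p q (X-cancelˡ _ _
    (≈ᴾ-trans (≈ᴾ-sym (*ᴾ-assoc X (pow R[X] X m) p)) (≈ᴾ-trans eq (*ᴾ-assoc X (pow R[X] X m) q))))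

  eval : Carrier → Polynomial → Carrier
  eval x []      = 0#
  eval x (a ∷ p) = a + x * eval x p

  -- Equal polynomials may be lists of different lengths; this disposes of the surplus tail in
  -- `eval-cong`.
  eval-zero : ∀ x p → (∀ n → coeff p n ≈ 0#) → eval x p ≈ 0#
  eval-zero x []      p≈0 = refl
  eval-zero x (a ∷ p) p≈0 = trans (+-cong (p≈0 0) (trans (*-congˡ (eval-zero x p (p≈0 ∘ suc))) (zeroʳ x))) (+-identityʳ _)

  eval-cong : ∀ x p q → (∀ n → coeff p n ≈ coeff q n) → eval x p ≈ eval x q
  eval-cong x []      q       p≈q = sym (eval-zero x q (sym ∘ p≈q))
  eval-cong x (a ∷ p) []      p≈q = eval-zero x (a ∷ p) p≈q
  eval-cong x (a ∷ p) (b ∷ q) p≈q = +-cong (p≈q 0) (*-congˡ (eval-cong x p q (p≈q ∘ suc)))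

  eval-+ : ∀ x p q → eval x (p +ᴾ q) ≈ eval x p + eval x q
  eval-+ x []      q       = sym (+-identityˡ _)
  eval-+ x (a ∷ p) []      = sym (+-identityʳ _)
  eval-+ x (a ∷ p) (b ∷ q) = trans (+-congˡ (*-congˡ (eval-+ x p q)))
    (solve 5 (λ a b x p q → ((a :+ b) :+ x :* (p :+ q)) := ((a :+ x :* p) :+ (b :+ x :* q))) refl _ _ _ _ _)

  eval-scale : ∀ x a p → eval x (scale a p) ≈ a * eval x p
  eval-scale x a []      = sym (zeroʳ a)
  eval-scale x a (b ∷ p) = trans (+-congˡ (*-congˡ (eval-scale x a p)))
    (solve 4 (λ a b x p → (a :* b :+ x :* (a :* p)) := (a :* (b :+ x :* p))) refl _ _ _ _)

  eval-* : ∀ x p q → eval x (p *ᴾ q) ≈ eval x p * eval x q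
  eval-* x []      q = sym (zeroˡ _)
  eval-* x (a ∷ p) q = begin
    eval x (scale a q +ᴾ (0# ∷ (p *ᴾ q)))            ≈⟨ eval-+ x (scale a q) _ ⟩
    eval x (scale a q) + (0# + x * eval x (p *ᴾ q))  ≈⟨ +-cong (eval-scale x a q) (trans (+-identityˡ _) (*-congˡ (eval-* x p q))) ⟩
    a * eval x q + x * (eval x p * eval x q)         ≈⟨ solve 4 (λ a x p q → (a :* q :+ x :* (p :* q)) := ((a :+ x :* p) :* q)) refl _ _ _ _ ⟩
    (a + x * eval x p) * eval x q                    ∎

  eval-neg : ∀ x p → eval x (-ᴾ p) ≈ - eval x p
  eval-neg x []      = sym -0#≈0#
  eval-neg x (a ∷ p) = begin
    - a + x * eval x (-ᴾ p)   ≈⟨ +-congˡ (trans (*-congˡ (eval-neg x p)) (sym (-‿distribʳ-* _ _))) ⟩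
    - a + - (x * eval x p)    ≈⟨ -‿+-comm _ _ ⟩
    - (a + x * eval x p)      ∎

  eval-constant : ∀ x a → eval x (constant a) ≈ a
  eval-constant x a = trans (+-congˡ (zeroʳ x)) (+-identityʳ a)

  eval-X : ∀ x → eval x X ≈ x
  eval-X x = trans (+-identityˡ _) (trans (*-congˡ (eval-constant x 1#)) (*-identityʳ x))

  open RingMorphisms (CommutativeRing.rawRing R[X]) rawRing using (IsRingHomomorphism)

  eval-homomorphism : ∀ x → IsRingHomomorphism (eval x)
  eval-homomorphism x = record
    { isSemiringHomomorphism = record
      { isNearSemiringHomomorphism = record
        { +-isMonoidHomomorphism = record
          { isMagmaHomomorphism = record
            { isRelHomomorphism = record { cong = λ {p} {q} p≈q → eval-cong x p q (coeff-≈ p≈q) }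
            ; homo = eval-+ x }
          ; ε-homo = refl }
        ; *-homo = eval-* x }
      ; 1#-homo = eval-constant x 1# }
    ; -‿homo = eval-neg x }

-- Determinants under ring homomorphisms.

module _ {c₁ ℓ₁ c₂ ℓ₂} (S : CommutativeRing c₁ ℓ₁) (R : CommutativeRing c₂ ℓ₂) where
  private
    module S = CommutativeRing S
    module DS = Determinants S
    module DR = Determinants R
  open CommutativeRing R hiding (zero)
  open RingMorphisms S.rawRing rawRing using (IsRingHomomorphism)
  open import Relation.Binary.Reasoning.Setoid setoid

  module _ {h : S.Carrier → Carrier} (h-homomorphism : IsRingHomomorphism h) where
    open IsRingHomomorphism h-homomorphism

    pow-homo : ∀ x n → h (pow S x n) ≈ pow R (h x) n
    pow-homo x zero    = 1#-homo
    pow-homo x (suc n) = trans (*-homo x _) (*-congˡ (pow-homo x n))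

    pow-cong : ∀ {x y} → x ≈ y → ∀ n → pow R x n ≈ pow R y n
    pow-cong x≈y zero    = refl
    pow-cong x≈y (suc n) = *-cong x≈y (pow-cong x≈y n)

    sumFin-homo : ∀ n (f : Fin n → S.Carrier) → h (sumFin S n f) ≈ sumFin R n (h ∘ f)
    sumFin-homo zero    f = 0#-homo
    sumFin-homo (suc n) f = trans (+-homo _ _) (+-congˡ (sumFin-homo n (f ∘ suc)))

    ∑-homo : ∀ {n} (f : Fin n → S.Carrier) → h (DS.∑ f) ≈ DR.∑ (h ∘ f)
    ∑-homo {n} f = begin
      h (DS.∑ f)             ≡⟨ ≡.cong h (DS.∑-def f) ⟩
      h (sumFin S n f)       ≈⟨ sumFin-homo n f ⟩
      sumFin R n (h ∘ f)     ≡⟨ DR.∑-def (h ∘ f) ⟨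
      DR.∑ (h ∘ f)           ∎

    Det-homo : ∀ {n} (A : DS.Matrix n n) → h (DS.Det A) ≈ DR.Det (λ i j → h (A i j))
    Det-homo {zero}  A = trans (trans (reflexive (≡.cong h (DS.Det-zero A))) 1#-homo) (sym (reflexive (DR.Det-zero _)))
    Det-homo {suc n} A = begin
      h (DS.Det A)
        ≡⟨ ≡.cong h (DS.Det-suc A) ⟩
      h (DS.∑ (λ j → DS.sign (toℕ j) S.* (A zero j S.* DS.Det (DS.minor j A))))
        ≈⟨ ∑-homo _ ⟩
      DR.∑ (λ j → h (DS.sign (toℕ j) S.* (A zero j S.* DS.Det (DS.minor j A))))
        ≈⟨ DR.∑-cong (λ j → trans (*-homo _ _) (*-cong
             (trans (pow-homo _ (toℕ j)) (pow-cong (trans (-‿homo _) (-‿cong 1#-homo)) (toℕ j)))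
             (trans (*-homo _ _) (*-congˡ (Det-homo (DS.minor j A)))))) ⟩
      DR.∑ (λ j → DR.sign (toℕ j) * (h (A zero j) * DR.Det (DR.minor j (λ i j → h (A i j)))))
        ≡⟨ DR.Det-suc _ ⟨
      DR.Det (λ i j → h (A i j)) ∎

    I-homo : ∀ {n} i j → h (DS.I {n} i j) ≈ DR.I i j
    I-homo zero    zero    = 1#-homo
    I-homo zero    (suc j) = 0#-homo
    I-homo (suc i) zero    = 0#-homo
    I-homo (suc i) (suc j) = I-homo i j

    Det-⊝-·-homo : ∀ {n} x (A B : DS.Matrix n n) →
      h (DS.Det (x DS.⊝ A DS.· B)) ≈ DR.Det (h x DR.⊝ (λ i j → h (A i j)) DR.· (λ i j → h (B i j)))
    Det-⊝-·-homo x A B = trans (Det-homo _) (DR.Det-cong λ i j →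
      trans (+-homo _ _) (+-cong (trans (*-homo _ _) (*-congˡ (I-homo i j)))
        (trans (-‿homo _) (-‿cong (trans (∑-homo _) (DR.∑-cong λ k → *-homo _ _))))))

-- Equality of the two characteristic polynomials at every ring element.

module _ {c ℓ} (R : CommutativeRing c ℓ) where
  open CommutativeRing R hiding (zero)
  open Determinants R
  open Polynomials R
  private module DP = Determinants R[X]
  open import Relation.Binary.Reasoning.Setoid setoid

  -- Over R[X] the scaled identity may be divided by X^n.
  Det-⊝-comm : ∀ {n} a (U V : Matrix n n) → Det (a ⊝ U · V) ≈ Det (a ⊝ V · U)
  Det-⊝-comm {n} a U V = begin
    Det (a ⊝ U · V)                       ≈⟨ evaluate U V ⟨
    eval a (DP.Det (X DP.⊝ Uᴾ DP.· Vᴾ))   ≈⟨ ⟦⟧-cong {DP.Det (X DP.⊝ Uᴾ DP.· Vᴾ)} (X^-cancelˡ n _ _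
      (≈ᴾ-trans (*ᴾ-comm (pow R[X] X n) (DP.Det (X DP.⊝ Uᴾ DP.· Vᴾ))) (DP.Det-⊝-comm-scaled X Uᴾ Vᴾ))) ⟩
    eval a (DP.Det (X DP.⊝ Vᴾ DP.· Uᴾ))   ≈⟨ evaluate V U ⟩
    Det (a ⊝ V · U)                       ∎
    where
    open RingMorphisms (CommutativeRing.rawRing R[X]) rawRing
    hom : IsRingHomomorphism (eval a)
    hom = eval-homomorphism a
    open IsRingHomomorphism hom using (⟦⟧-cong)

    -- The entries enter as constants, so evaluation at `a` recovers `U` and `V` and sends `X` to
    -- `a`.
    Uᴾ Vᴾ : DP.Matrix n n
    Uᴾ i j = constant (U i j)
    Vᴾ i j = constant (V i j)

    evaluate : ∀ (A B : Matrix n n) →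
               eval a (DP.Det (X DP.⊝ (λ i j → constant (A i j)) DP.· (λ i j → constant (B i j)))) ≈ Det (a ⊝ A · B)
    evaluate A B = trans (Det-⊝-·-homo R[X] R hom X (λ i j → constant (A i j)) (λ i j → constant (B i j)))
      (Det-cong λ i j → +-cong (*-congʳ (eval-X a)) (-‿cong (∑-cong λ k →
        *-cong (eval-constant a (A i k)) (eval-constant a (B k j)))))

-- Together with symmetry of `E`, this describes a partial involution of the entries of `xs` defined
-- on `U`. Giving it as a relation, with partners required to lie in the list, lets it pass to
-- permuted lists and to suffixes.
record PartialMatching (U : ℕ → Set) (E : ℕ → ℕ → Set) (xs : List ℕ) : Set where
  field
    unique     : Unique xs
    matched    : ∀ {k} → k ∈ xs → U k → ∃[ l ] (l ∈ xs × E k l)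
    functional : ∀ {k l l′} → k ∈ xs → l ∈ xs → l′ ∈ xs → E k l → E k l′ → l ≡ l′

module _ {U : ℕ → Set} {E : ℕ → ℕ → Set} where
  matching-resp-↭ : ∀ {xs ys} → xs ↭ ys → PartialMatching U E xs → PartialMatching U E ys
  matching-resp-↭ xs↭ys M = record
    { unique     = Permₛ.Unique-resp-↭ (≡.setoid ℕ) (↭⇒↭ₛ xs↭ys) unique
    ; matched    = λ k∈ys Uk → let l , l∈xs , Ekl = matched (back k∈ys) Uk in l , ∈-resp-↭ xs↭ys l∈xs , Ekl
    ; functional = λ k∈ l∈ l′∈ → functional (back k∈) (back l∈) (back l′∈) }
    where
    open PartialMatching M
    back : ∀ {k} → k ∈ _ → k ∈ _
    back = ∈-resp-↭ (↭-sym xs↭ys)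

  -- The partner of an entry of `xs` cannot lie in `ws`, since no edge joins the two lists. This
  -- allows a non-unit, a fixed point or a whole 2-cycle to be split off.
  matching-suffix : (∀ {k l} → E k l → E l k) → ∀ ws {xs} → (∀ {w k} → w ∈ ws → k ∈ xs → ¬ E w k) →
                    PartialMatching U E (ws ++ xs) → PartialMatching U E xs
  matching-suffix E-sym ws {xs} ws-isolated M = record
    { unique     = unique-suffix ws unique
    ; matched    = λ k∈xs Uk → let l , l∈ , Ekl = matched (∈-++⁺ʳ ws k∈xs) Uk in
                     l , fromInj₂ (λ l∈ws → ⊥-elim (ws-isolated l∈ws k∈xs (E-sym Ekl))) (∈-++⁻ ws l∈) , Ekl
    ; functional = λ k∈ l∈ l′∈ → functional (∈-++⁺ʳ ws k∈) (∈-++⁺ʳ ws l∈) (∈-++⁺ʳ ws l′∈) }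
    where
    open PartialMatching M
    unique-suffix : ∀ ws → Unique (ws ++ xs) → Unique xs
    unique-suffix []       u       = u
    unique-suffix (w ∷ ws) (_ ∷ u) = unique-suffix ws u

  head≢ : ∀ {x xs k} → PartialMatching U E (x ∷ xs) → k ∈ xs → x ≢ k
  head≢ M k∈xs with PartialMatching.unique M
  ... | x∉xs ∷ _ = All.lookup x∉xs k∈xs

-- The determinant attached to a partial matching.

module MatchingDeterminant {c ℓ : Level} (R : CommutativeRing c ℓ) (a t : CommutativeRing.Carrier R)
  {U F : ℕ → Set} {E : ℕ → ℕ → Set}
  (U? : ∀ k → Dec (U k)) (F? : ∀ k → Dec (F k)) (E? : ∀ k l → Dec (E k l))
  (E-sym : ∀ {k l} → E k l → E l k) (E⇒U : ∀ {k l} → E k l → U k)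
  (F⇒E : ∀ {k} → U k → F k → E k k) (E⇒F : ∀ {k} → E k k → F k) where
  open CommutativeRing R hiding (zero)
  open Determinants R
  open import Algebra.Properties.Ring ring using (-0#≈0#; -1*x≈-x; -‿distribʳ-*; -‿involutive)
  open import Relation.Binary.Reasoning.Setoid setoid
  open import Algebra.Solver.Ring.NaturalCoefficients.Default commutativeSemiring using (solve; _:+_; _:*_; _:=_)

  -- Entries of the characteristic matrix are indexed by the numbers themselves rather than by their
  -- positions, so that reordering the list permutes rows and columns alike.
  entry : ℕ → ℕ → Carrier
  entry k l = a * (if does (k ℕ.≟ l) then 1# else 0#) - (if does (E? k l) then t else 0#)

  listMatrix : (xs : List ℕ) → Matrix (length xs) (length xs)
  listMatrix xs i j = entry (lookup xs i) (lookup xs j)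

  module _ {k l : ℕ} where
    entry-off : k ≢ l → ¬ E k l → entry k l ≈ 0#
    entry-off k≢l ¬E rewrite dec-false (k ℕ.≟ l) k≢l | dec-false (E? k l) ¬E =
      trans (+-cong (zeroʳ a) -0#≈0#) (+-identityʳ 0#)

    entry-matched : k ≢ l → E k l → entry k l ≈ - t
    entry-matched k≢l Ekl rewrite dec-false (k ℕ.≟ l) k≢l | dec-true (E? k l) Ekl =
      trans (+-congʳ (zeroʳ a)) (+-identityˡ _)

  module _ (k : ℕ) where
    entry-diag : ¬ E k k → entry k k ≈ a
    entry-diag ¬E rewrite dec-true (k ℕ.≟ k) ≡.refl | dec-false (E? k k) ¬E =
      trans (+-cong (*-identityʳ a) -0#≈0#) (+-identityʳ a)

    entry-fixed : E k k → entry k k ≈ a - t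
    entry-fixed Ekk rewrite dec-true (k ℕ.≟ k) ≡.refl | dec-true (E? k k) Ekk =
      +-congʳ (*-identityʳ a)

  Det-listMatrix-↭ : ∀ {xs ys} → xs ↭ ys → Det (listMatrix xs) ≈ Det (listMatrix ys)
  Det-listMatrix-↭ {xs} {ys} xs↭ys = trans
    (Det-cong λ i j → reflexive (≡.cong₂ entry (lookups i) (lookups j)))
    (Det-reindex (onIndices (↭⇒↭ₛ xs↭ys)) (listMatrix ys))
    where lookups = Permₛ.onIndices-lookup (≡.setoid ℕ) (↭⇒↭ₛ xs↭ys)

  Det-2 : ∀ (A : Matrix 2 2) → Det A ≈ A zero zero * A (suc zero) (suc zero) - A zero (suc zero) * A (suc zero) zero
  Det-2 A = begin
    Det A
      ≡⟨ Det-suc A ⟩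
    ∑ (λ j → sign (toℕ j) * (A zero j * Det (minor j A)))
      ≡⟨ ≡.trans (∑-suc _) (≡.cong (1# * (A zero zero * Det (minor zero A)) +_) (∑-suc _)) ⟩
    1# * (A zero zero * Det (minor zero A)) + (- 1# * 1# * (A zero (suc zero) * Det (minor (suc zero) A)) + ∑ _)
      ≈⟨ +-cong (trans (*-identityˡ _) (*-congˡ (Det-1 (minor zero A))))
                (trans (+-cong (trans (*-congʳ (*-identityʳ _)) (trans (-1*x≈-x _) (-‿cong (*-congˡ (Det-1 (minor (suc zero) A))))))
                               (∑-zero λ ())) (+-identityʳ _)) ⟩
    A zero zero * A (suc zero) (suc zero) - A zero (suc zero) * A (suc zero) zero ∎

  Det-listMatrix-∷ : ∀ x xs → (∀ {k} → k ∈ xs → x ≢ k) → (∀ {k} → k ∈ xs → ¬ E x k) →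
                     Det (listMatrix (x ∷ xs)) ≈ entry x x * Det (listMatrix xs)
  Det-listMatrix-∷ x xs x≢ x-isolated = trans
    (Det-block-triangular 1 (listMatrix (x ∷ xs)) (λ { zero j → entry-off (x≢ (∈-lookup j)) (x-isolated (∈-lookup j)) }))
    (*-congʳ (Det-1 (λ i j → listMatrix (x ∷ xs) (i ↑ˡ length xs) (j ↑ˡ length xs))))

  Det-listMatrix-pair : ∀ x y xs → x ≢ y → E x y → ¬ E x x → ¬ E y y →
    (∀ {k} → k ∈ xs → x ≢ k) → (∀ {k} → k ∈ xs → y ≢ k) → (∀ {k} → k ∈ xs → ¬ E x k) → (∀ {k} → k ∈ xs → ¬ E y k) →
    Det (listMatrix (x ∷ y ∷ xs)) ≈ (a - t) * (a + t) * Det (listMatrix xs)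
  Det-listMatrix-pair x y xs x≢y Exy ¬Exx ¬Eyy x≢ y≢ x-isolated y-isolated = trans
    (Det-block-triangular 2 (listMatrix (x ∷ y ∷ xs)) λ
      { zero       j → entry-off (x≢ (∈-lookup j)) (x-isolated (∈-lookup j))
      ; (suc zero) j → entry-off (y≢ (∈-lookup j)) (y-isolated (∈-lookup j)) })
    (*-congʳ (begin
      Det corner
        ≈⟨ Det-2 corner ⟩
      entry x x * entry y y - entry x y * entry y x
        ≈⟨ +-cong (*-cong (entry-diag x ¬Exx) (entry-diag y ¬Eyy))
             (-‿cong (*-cong (entry-matched x≢y Exy) (entry-matched (x≢y ∘ ≡.sym) (E-sym Exy)))) ⟩
      a * a - (- t * - t)
        ≈⟨ +-congˡ (trans (-‿distribʳ-* _ _) (*-congˡ (-‿involutive t))) ⟩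
      a * a + - t * t
        -- The vanishing cross terms `a * (- t + t)` are inserted because with them the
        -- factorisation becomes a semiring identity, valid with any `s` in place of `- t`.
        ≈⟨ +-congʳ (trans (+-congˡ (trans (*-congˡ (-‿inverseˡ t)) (zeroʳ a))) (+-identityʳ _)) ⟨
      (a * a + a * (- t + t)) + - t * t
        ≈⟨ solve 3 (λ a s t → ((a :* a :+ a :* (s :+ t)) :+ s :* t) := ((a :+ s) :* (a :+ t))) refl a (- t) t ⟩
      (a - t) * (a + t) ∎))
    where
    corner : Matrix 2 2
    corner i j = listMatrix (x ∷ y ∷ xs) (i ↑ˡ length xs) (j ↑ˡ length xs)

  #U #F : List ℕ → ℕ
  #U xs = length (filter U? xs)
  #F xs = length (filter F? (filter U? xs))

  -- Counting pairs avoids halving during the induction. From `#U ≡ #F + 2 #pairs`, half of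
  -- `#U + #F` is `#F + #pairs` and half of `#U - #F` is `#pairs`: a fixed point supplies one factor
  -- `a - t`, a pair one of each kind.
  record Factorisation (xs : List ℕ) : Set ℓ where
    constructor factors
    field
      #zeros #pairs : ℕ
      length≡       : length xs ≡ #zeros ℕ.+ #U xs
      #U≡           : #U xs ≡ #F xs ℕ.+ (#pairs ℕ.+ #pairs)
      Det≈          : Det (listMatrix xs) ≈
                      pow R a #zeros * (pow R (a - t) (#F xs ℕ.+ #pairs) * pow R (a + t) #pairs)

  factorisation-resp-↭ : ∀ {xs ys} → ys ↭ xs → Factorisation xs → Factorisation ys
  factorisation-resp-↭ {xs} {ys} ys↭xs (factors z p len cnt det) =
    factors z p (≡.trans lengths (≡.trans len (≡.cong (z ℕ.+_) (≡.sym #Us))))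
    (≡.trans #Us (≡.trans cnt (≡.cong (ℕ._+ _) (≡.sym #Fs))))
    (trans (Det-listMatrix-↭ ys↭xs) (trans det (reflexive
      (≡.cong (λ f → pow R a z * (pow R (a - t) (f ℕ.+ p) * pow R (a + t) p)) (≡.sym #Fs)))))
    where
    lengths : length ys ≡ length xs
    lengths = ↭-length ys↭xs
    #Us : #U ys ≡ #U xs
    #Us = ↭-length (filter-↭ U? ys↭xs)
    #Fs : #F ys ≡ #F xs
    #Fs = ↭-length (filter-↭ F? (filter-↭ U? ys↭xs))

  #U-accept : ∀ {x xs} → U x → #U (x ∷ xs) ≡ suc (#U xs)
  #U-accept Ux = ≡.cong length (filter-accept U? Ux)

  #F-accept : ∀ {x xs} → U x → F x → #F (x ∷ xs) ≡ suc (#F xs)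
  #F-accept Ux Fx = ≡.trans (≡.cong (length ∘ filter F?) (filter-accept U? Ux)) (≡.cong length (filter-accept F? Fx))

  #F-reject : ∀ {x xs} → U x → ¬ F x → #F (x ∷ xs) ≡ #F xs
  #F-reject Ux ¬Fx = ≡.trans (≡.cong (length ∘ filter F?) (filter-accept U? Ux)) (≡.cong length (filter-reject F? ¬Fx))

  factorisation-∷-nonunit : ∀ {x xs} → ¬ U x → (∀ {k} → k ∈ xs → x ≢ k) → Factorisation xs → Factorisation (x ∷ xs)
  factorisation-∷-nonunit {x} {xs} ¬Ux x≢ (factors z p len cnt det) =
    factors (suc z) p (≡.cong suc (≡.trans len (≡.cong (z ℕ.+_) (≡.sym #Us))))
    (≡.trans #Us (≡.trans cnt (≡.cong (ℕ._+ _) (≡.sym #Fs)))) (begin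
      Det (listMatrix (x ∷ xs))
        ≈⟨ Det-listMatrix-∷ x xs x≢ (λ _ → ¬Ux ∘ E⇒U) ⟩
      entry x x * Det (listMatrix xs)
        ≈⟨ *-cong (entry-diag x (¬Ux ∘ E⇒U)) det ⟩
      a * (pow R a z * (pow R (a - t) (#F xs ℕ.+ p) * pow R (a + t) p))
        ≈⟨ *-assoc _ _ _ ⟨
      pow R a (suc z) * (pow R (a - t) (#F xs ℕ.+ p) * pow R (a + t) p)
        ≡⟨ ≡.cong (λ f → pow R a (suc z) * (pow R (a - t) (f ℕ.+ p) * pow R (a + t) p)) #Fs ⟨
      pow R a (suc z) * (pow R (a - t) (#F (x ∷ xs) ℕ.+ p) * pow R (a + t) p) ∎)
    where
    #Us : #U (x ∷ xs) ≡ #U xs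
    #Us = ≡.cong length (filter-reject U? ¬Ux)
    #Fs : #F (x ∷ xs) ≡ #F xs
    #Fs = ≡.cong (length ∘ filter F?) (filter-reject U? ¬Ux)

  factorisation-∷-fixed : ∀ {x xs} → E x x → (∀ {k} → k ∈ xs → x ≢ k) → (∀ {k} → k ∈ xs → ¬ E x k) →
                          Factorisation xs → Factorisation (x ∷ xs)
  factorisation-∷-fixed {x} {xs} Exx x≢ x-isolated (factors z p len cnt det) =
    factors z p (≡.trans (≡.cong suc len) (≡.trans (≡.sym (ℕₚ.+-suc z _)) (≡.cong (z ℕ.+_) (≡.sym #Us))))
    (≡.trans #Us (≡.trans (≡.cong suc cnt) (≡.cong (ℕ._+ _) (≡.sym #Fs)))) (begin
      Det (listMatrix (x ∷ xs))
        ≈⟨ Det-listMatrix-∷ x xs x≢ x-isolated ⟩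
      entry x x * Det (listMatrix xs)
        ≈⟨ *-cong (entry-fixed x Exx) det ⟩
      (a - t) * (pow R a z * (pow R (a - t) (#F xs ℕ.+ p) * pow R (a + t) p))
        ≈⟨ solve 4 (λ b x y z → (b :* (x :* (y :* z))) := (x :* ((b :* y) :* z))) refl _ _ _ _ ⟩
      pow R a z * (pow R (a - t) (suc (#F xs) ℕ.+ p) * pow R (a + t) p)
        ≡⟨ ≡.cong (λ f → pow R a z * (pow R (a - t) (f ℕ.+ p) * pow R (a + t) p)) #Fs ⟨
      pow R a z * (pow R (a - t) (#F (x ∷ xs) ℕ.+ p) * pow R (a + t) p) ∎)
    where
    #Us : #U (x ∷ xs) ≡ suc (#U xs)
    #Us = #U-accept (E⇒U Exx)
    #Fs : #F (x ∷ xs) ≡ suc (#F xs)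
    #Fs = #F-accept (E⇒U Exx) (E⇒F Exx)

  factorisation-∷-pair : ∀ {x y xs} → x ≢ y → E x y → ¬ E x x → ¬ E y y →
    (∀ {k} → k ∈ xs → x ≢ k) → (∀ {k} → k ∈ xs → y ≢ k) → (∀ {k} → k ∈ xs → ¬ E x k) → (∀ {k} → k ∈ xs → ¬ E y k) →
    Factorisation xs → Factorisation (x ∷ y ∷ xs)
  factorisation-∷-pair {x} {y} {xs} x≢y Exy ¬Exx ¬Eyy x≢ y≢ x-isolated y-isolated (factors z p len cnt det) =
    factors z (suc p)
    (≡.trans (≡.cong (2 ℕ.+_) len) (≡.trans (≡.sym (≡.trans (ℕₚ.+-suc z _) (≡.cong suc (ℕₚ.+-suc z _)))) (≡.cong (z ℕ.+_) (≡.sym #Us))))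
    (≡.trans #Us (≡.trans (≡.cong (2 ℕ.+_) cnt) (≡.trans (arith (#F xs) p) (≡.cong (ℕ._+ _) (≡.sym #Fs))))) (begin
      Det (listMatrix (x ∷ y ∷ xs))
        ≈⟨ Det-listMatrix-pair x y xs x≢y Exy ¬Exx ¬Eyy x≢ y≢ x-isolated y-isolated ⟩
      (a - t) * (a + t) * Det (listMatrix xs)
        ≈⟨ *-congˡ det ⟩
      (a - t) * (a + t) * (pow R a z * (pow R (a - t) (#F xs ℕ.+ p) * pow R (a + t) p))
        ≈⟨ solve 5 (λ b c x y z → (b :* c :* (x :* (y :* z))) := (x :* ((b :* y) :* (c :* z)))) refl _ _ _ _ _ ⟩
      pow R a z * (pow R (a - t) (suc (#F xs ℕ.+ p)) * pow R (a + t) (suc p))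
        ≡⟨ ≡.cong (λ e → pow R a z * (pow R (a - t) e * pow R (a + t) (suc p)))
             (≡.trans (≡.cong (ℕ._+ suc p) #Fs) (ℕₚ.+-suc _ p)) ⟨
      pow R a z * (pow R (a - t) (#F (x ∷ y ∷ xs) ℕ.+ suc p) * pow R (a + t) (suc p)) ∎)
    where
    Ux : U x
    Ux = E⇒U Exy
    Uy : U y
    Uy = E⇒U (E-sym Exy)
    #Us : #U (x ∷ y ∷ xs) ≡ suc (suc (#U xs))
    #Us = ≡.trans (#U-accept Ux) (≡.cong suc (#U-accept Uy))
    #Fs : #F (x ∷ y ∷ xs) ≡ #F xs
    #Fs = ≡.trans (#F-reject Ux (¬Exx ∘ F⇒E Ux)) (#F-reject Uy (¬Eyy ∘ F⇒E Uy))
    arith : ∀ f p → suc (suc (f ℕ.+ (p ℕ.+ p))) ≡ f ℕ.+ (suc p ℕ.+ suc p)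
    arith f p = ≡.sym (≡.trans (ℕₚ.+-suc f _) (≡.cong suc (≡.trans (≡.cong (f ℕ.+_) (ℕₚ.+-suc p p)) (ℕₚ.+-suc f _))))

  -- The first entry is a non-unit, its own partner, or matched to a later entry; its component
  -- under the matching is split off as a diagonal block. The bound `n` on the length carries the
  -- recursion, because removing a later partner leaves `as ++ bs`, which is not a tail of the given
  -- list.
  factorisation : ∀ n xs → length xs ℕ.≤ n → PartialMatching U E xs → Factorisation xs
  factorisation n       []       _        M = factors 0 0 ≡.refl ≡.refl
    (trans (reflexive (Det-zero _)) (sym (trans (*-identityˡ _) (*-identityˡ _))))
  factorisation (suc n) (x ∷ xs) (ℕ.s≤s xs≤n) M with U? x
  ... | no ¬Ux = factorisation-∷-nonunit ¬Ux (head≢ M)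
                   (factorisation n xs xs≤n (matching-suffix E-sym (x ∷ []) (λ { (here ≡.refl) _ → ¬Ux ∘ E⇒U }) M))
  ... | yes Ux with PartialMatching.matched M (here ≡.refl) Ux
  ...   | _ , here ≡.refl , Exx = factorisation-∷-fixed Exx (head≢ M) isolated
                                    (factorisation n xs xs≤n (matching-suffix E-sym (x ∷ []) (λ { (here ≡.refl) → isolated }) M))
    where
    isolated : ∀ {k} → k ∈ xs → ¬ E x k
    isolated k∈xs Exk = head≢ M k∈xs (PartialMatching.functional M (here ≡.refl) (here ≡.refl) (there k∈xs) Exx Exk)
  ...   | y , there y∈xs , Exy with ∈-∃++ y∈xs
  ...     | as , bs , ≡.refl = factorisation-resp-↭ σ (factorisation-∷-pair x≢y Exy ¬Exx ¬Eyy
              (λ k∈ → head≢ M′ (there k∈)) (λ k∈ → head≢ M-swapped (there k∈)) x-isolated y-isolated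
              (factorisation n (as ++ bs) (ℕₚ.≤-trans (ℕₚ.n≤1+n _) (≡.subst (ℕ._≤ n) (↭-length (shift y as bs)) xs≤n))
                 (matching-suffix E-sym (x ∷ y ∷ []) (λ { (here ≡.refl) → x-isolated ; (there (here ≡.refl)) → y-isolated }) M′)))
    where
    -- Moving the partner `y` next to `x` makes the 2-cycle the leading block of size two.
    σ : x ∷ as ++ y ∷ bs ↭ x ∷ y ∷ as ++ bs
    σ = prep x (shift y as bs)
    M′ : PartialMatching U E (x ∷ y ∷ as ++ bs)
    M′ = matching-resp-↭ σ M
    open PartialMatching M′
    x≢y : x ≢ y
    x≢y = head≢ M′ (here ≡.refl)
    ¬Exx : ¬ E x x
    ¬Exx Exx = x≢y (functional (here ≡.refl) (here ≡.refl) (there (here ≡.refl)) Exx Exy)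
    ¬Eyy : ¬ E y y
    ¬Eyy Eyy = x≢y (functional (there (here ≡.refl)) (here ≡.refl) (there (here ≡.refl)) (E-sym Exy) Eyy)
    -- `head≢` separates only the head from the rest, so `y` is brought to the front to separate it
    -- from `as ++ bs`.
    M-swapped : PartialMatching U E (y ∷ x ∷ as ++ bs)
    M-swapped = matching-resp-↭ (_↭_.swap x y _↭_.refl) M′
    x-isolated : ∀ {k} → k ∈ as ++ bs → ¬ E x k
    x-isolated k∈ Exk = head≢ M-swapped (there k∈) (functional (here ≡.refl) (there (here ≡.refl)) (there (there k∈)) Exy Exk)
    y-isolated : ∀ {k} → k ∈ as ++ bs → ¬ E y k
    y-isolated k∈ Eyk = head≢ M′ (there k∈) (functional (there (here ≡.refl)) (here ≡.refl) (there (there k∈)) (E-sym Exy) Eyk)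

-- Arithmetic modulo q and the involution k ↦ -k* on units.

module Residues (q′ : ℕ) where
  open import Data.Nat using (_+_; _*_)

  q : ℕ
  q = suc q′

  infix 4 _~_
  -- A record, so that `m` and `n` can be inferred from the type; the bare equation of remainders
  -- does not determine them.
  record _~_ (m n : ℕ) : Set where
    constructor mod
    field residue≡ : m % q ≡ n % q
  open _~_ public

  ~-refl : ∀ {m} → m ~ m
  ~-refl = mod ≡.refl

  ~-reflexive : ∀ {m n} → m ≡ n → m ~ n
  ~-reflexive ≡.refl = ~-refl

  ~-sym : ∀ {m n} → m ~ n → n ~ m
  ~-sym (mod e) = mod (≡.sym e)

  ~-trans : ∀ {l m n} → l ~ m → m ~ n → l ~ n
  ~-trans (mod e) (mod f) = mod (≡.trans e f)

  +-mod : ∀ {k l m n} → k ~ l → m ~ n → k + m ~ l + n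
  +-mod {k} {l} {m} {n} (mod e) (mod f) = mod (≡.trans (%-distribˡ-+ k m q)
    (≡.trans (≡.cong₂ (λ x y → (x + y) % q) e f) (≡.sym (%-distribˡ-+ l n q))))

  *-mod : ∀ {k l m n} → k ~ l → m ~ n → k * m ~ l * n
  *-mod {k} {l} {m} {n} (mod e) (mod f) = mod (≡.trans (%-distribˡ-* k m q)
    (≡.trans (≡.cong₂ (λ x y → (x * y) % q) e f) (≡.sym (%-distribˡ-* l n q))))

  k*q~0 : ∀ k → k * q ~ 0
  k*q~0 k = mod (m*n%n≡0 k q)

  -- In the natural numbers `q′ * k` plays the part of -k, because `q′ * k + k` is the multiple
  -- `k * q`.
  +-cancelˡ-mod : ∀ k {m n} → k + m ~ k + n → m ~ n
  +-cancelˡ-mod k {m} {n} e = ~-trans (~-sym (absorb m)) (~-trans (+-mod (~-refl {q′ * k}) e) (absorb n))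
    where
    expand : ∀ q′ k m → q′ * k + (k + m) ≡ m + k * suc q′
    expand = solve-∀
    absorb : ∀ m → q′ * k + (k + m) ~ m
    absorb m = mod (≡.trans (≡.cong (_% q) (expand q′ k m)) ([m+kn]%n≡m%n m k q))

  -- Adding `q′` subtracts 1 modulo q, and the outer `suc` restores it. The value thus lies in 1,
  -- ..., q as in `oneTo q`, with multiples of q represented by q instead of 0.
  representative : ℕ → ℕ
  representative r = suc ((r + q′) % q)

  representative~ : ∀ r → representative r ~ r
  representative~ r = ~-trans (+-mod {1} ~-refl (mod (m%n%n≡m%n (r + q′) q)))
    (mod (≡.trans (≡.cong (_% q) (lemma r q′)) ([m+kn]%n≡m%n r 1 q)))
    where
    lemma : ∀ r q′ → 1 + (r + q′) ≡ r + 1 * suc q′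
    lemma = solve-∀

  representative∈ : ∀ r → representative r ∈ oneTo q
  representative∈ r = ∈-map⁺ suc (∈-upTo⁺ (m%n<n (r + q′) q))

  oneTo-unique : Unique (oneTo q)
  oneTo-unique = map⁺ ℕₚ.suc-injective (upTo⁺ q)

  ~⇒≡ : ∀ {k l} → k ∈ oneTo q → l ∈ oneTo q → k ~ l → k ≡ l
  ~⇒≡ k∈ l∈ k~l with ∈-map⁻ suc k∈ | ∈-map⁻ suc l∈
  ... | i , i∈ , ≡.refl | j , j∈ , ≡.refl = ≡.cong suc (≡.trans (≡.sym (m<n⇒m%n≡m (∈-upTo⁻ i∈)))
    (≡.trans (residue≡ (+-cancelˡ-mod 1 k~l)) (m<n⇒m%n≡m (∈-upTo⁻ j∈))))

  Unit : ℕ → Set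
  Unit k = gcd k q ≡ 1

  -- l ≡ − k* modulo q, written without inverses.
  Opposite : ℕ → ℕ → Set
  Opposite k l = (1 + k * l) % q ≡ 0

  unit? : ∀ k → Dec (Unit k)
  unit? k = gcd k q ℕ.≟ 1

  opposite? : ∀ k l → Dec (Opposite k l)
  opposite? k l = (1 + k * l) % q ℕ.≟ 0

  unit-invertible : ∀ k → Unit k → ∃[ j ] k * j ~ 1
  unit-invertible k u with coprime-Bézout (gcd≡1⇒coprime u)
  ... | Bézout.+- x y eq = x ,
    ~-trans (~-reflexive (≡.trans (ℕₚ.*-comm k x) (≡.sym eq))) (+-mod {1} ~-refl (k*q~0 y))
  -- Here `1 + x * k` is a multiple of q, so the inverse is -x, written as `q′ * x`.
  ... | Bézout.-+ x y eq = q′ * x , +-cancelˡ-mod q′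
    (~-trans (~-reflexive (≡.trans (expand q′ x k) (≡.cong (q′ *_) eq)))
    (~-trans (*-mod {q′} ~-refl (k*q~0 y)) (~-trans (~-reflexive (ℕₚ.*-zeroʳ q′)) (~-trans (~-sym (k*q~0 1)) (~-reflexive (one q′))))))
    where
    expand : ∀ q′ x k → q′ + k * (q′ * x) ≡ q′ * (1 + x * k)
    expand = solve-∀
    one : ∀ q′ → 1 * suc q′ ≡ q′ + 1
    one = solve-∀

  findInv-correct : ∀ k {j} js → j ∈ js → k * j ~ 1 → k * findInv q′ k js ~ 1
  findInv-correct k (i ∷ js) j∈ kj~1 with (k * i) % q ℕ.≟ 1 % q
  findInv-correct k (i ∷ js) j∈          kj~1 | yes e = mod e
  findInv-correct k (i ∷ js) (here ≡.refl) kj~1 | no  e = ⊥-elim (e (residue≡ kj~1))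
  findInv-correct k (i ∷ js) (there j∈)  kj~1 | no  e = findInv-correct k js j∈ kj~1

  -- The search in `inv` visits only 1, ..., q. Replacing the Bézout inverse by its representative
  -- in that range shows that the search succeeds before reaching its default value.
  inv-correct : ∀ k → Unit k → k * inv q′ k ~ 1
  inv-correct k u with unit-invertible k u
  ... | j , kj~1 = findInv-correct k (oneTo q) (representative∈ j) (~-trans (*-mod {k} ~-refl (representative~ j)) kj~1)

  -- Multiplying `1 + k * l` by k* gives k* + l modulo q; the converse `inv⇒opposite` multiplies by
  -- `k`.
  opposite⇒inv : ∀ k l → Unit k → Opposite k l → (inv q′ k + l) % q ≡ 0
  opposite⇒inv k l u o = residue≡ (~-trans
    (+-mod {inv q′ k} ~-refl (~-trans (~-reflexive (≡.sym (ℕₚ.*-identityˡ l))) (*-mod {m = l} (~-sym (inv-correct k u)) ~-refl)))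
    (~-trans (~-reflexive (factor (inv q′ k) k l)) (~-trans (*-mod {inv q′ k} ~-refl (mod {n = 0} o)) (~-reflexive (ℕₚ.*-zeroʳ (inv q′ k))))))
    where
    factor : ∀ j k l → j + k * j * l ≡ j * (1 + k * l)
    factor = solve-∀

  inv⇒opposite : ∀ k l → Unit k → (inv q′ k + l) % q ≡ 0 → Opposite k l
  inv⇒opposite k l u e = residue≡ (~-trans (+-mod {m = k * l} (~-sym (inv-correct k u)) ~-refl)
    (~-trans (~-reflexive (≡.sym (ℕₚ.*-distribˡ-+ k (inv q′ k) l)))
      (~-trans (*-mod {k} ~-refl (mod {n = 0} e)) (~-reflexive (ℕₚ.*-zeroʳ k)))))

  opposite-sym : ∀ k l → Opposite k l → Opposite l k
  opposite-sym k l o = ≡.trans (≡.cong (λ m → (1 + m) % q) (ℕₚ.*-comm l k)) o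

  -- The gcd divides `1 + k * l` through `q` and `k * l` through `k`, hence it divides 1. This
  -- confines all edges of the matching to units.
  opposite⇒unit : ∀ k l → Opposite k l → Unit k
  opposite⇒unit k l o = ∣1⇒≡1 (∣m+n∣m⇒∣n
    (≡.subst (gcd k q ∣_) (ℕₚ.+-comm 1 (k * l)) (∣-trans (gcd[m,n]∣n k q) (m%n≡0⇒n∣m (1 + k * l) q o)))
    (∣m⇒∣m*n l (gcd[m,n]∣m k q)))

  opposite-functional : ∀ k l l′ → Opposite k l → Opposite k l′ → l ~ l′
  opposite-functional k l l′ o o′ = +-cancelˡ-mod (inv q′ k)
    (mod (≡.trans (opposite⇒inv k l u o) (≡.sym (opposite⇒inv k l′ u o′))))
    where
    u : Unit k
    u = opposite⇒unit k l o

  opposite-exists : ∀ k → Unit k → ∃[ l ] (l ∈ oneTo q × Opposite k l)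
  opposite-exists k u = l , representative∈ (q′ * inv q′ k) , inv⇒opposite k l u (residue≡ (~-trans
    (+-mod {inv q′ k} ~-refl (representative~ (q′ * inv q′ k))) (~-trans (~-reflexive (factor (inv q′ k) q′)) (k*q~0 (inv q′ k)))))
    where
    -- The residue -k*, with `q′` acting as -1 modulo q.
    l = representative (q′ * inv q′ k)
    factor : ∀ j q′ → j + q′ * j ≡ j * suc q′
    factor = solve-∀

  opposite-matching : PartialMatching Unit Opposite (oneTo q)
  opposite-matching = record
    { unique     = oneTo-unique
    ; matched    = λ {k} _ → opposite-exists k
    ; functional = λ {k} {l} {l′} _ l∈ l′∈ o o′ → ~⇒≡ l∈ l′∈ (opposite-functional k l l′ o o′) }

-- Stated for a general `f` because the tail of an `upTo` list is again an `applyUpTo`, but with a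
-- shifted function.
lookup-map-suc-applyUpTo : ∀ (f : ℕ → ℕ) n (i : Fin (length (map ℕ.suc (applyUpTo f n)))) → lookup (map ℕ.suc (applyUpTo f n)) i ≡ suc (f (toℕ i))
lookup-map-suc-applyUpTo f (suc n) zero    = ≡.refl
lookup-map-suc-applyUpTo f (suc n) (suc i) = lookup-map-suc-applyUpTo (f ∘ suc) n i

open import Data.Nat using (_∸_; _+_; _/_)

-- The Kloosterman matrix and its characteristic polynomial.

module KloostermanMatrix {c ℓ : Level} (R : CommutativeRing c ℓ) (q′ : ℕ) (ζ : CommutativeRing.Carrier R)
  (ζ-primitive : IsPrimitiveRoot R q′ ζ) where
  open CommutativeRing R hiding (zero) renaming (_+_ to _⊕_)
  open Determinants R
  open Residues q′
  open import Relation.Binary.Reasoning.Setoid setoid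

  e : ℕ → Carrier
  e = pow R ζ

  e-+ : ∀ m n → e (m + n) ≈ e m * e n
  e-+ zero    n = sym (*-identityˡ _)
  e-+ (suc m) n = trans (*-congˡ (e-+ m n)) (sym (*-assoc _ _ _))

  e-multiple : ∀ k → e (k ℕ.* q) ≈ 1#
  e-multiple zero    = refl
  e-multiple (suc k) = trans (e-+ q (k ℕ.* q)) (trans (*-cong (proj₁ ζ-primitive) (e-multiple k)) (*-identityˡ 1#))

  e-% : ∀ m → e m ≈ e (m % q)
  e-% m = begin
    e m                               ≡⟨ ≡.cong e (m≡m%n+[m/n]*n m q) ⟩
    e (m % q + (m / q) ℕ.* q)         ≈⟨ e-+ (m % q) _ ⟩
    e (m % q) * e ((m / q) ℕ.* q)     ≈⟨ *-congˡ (e-multiple (m / q)) ⟩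
    e (m % q) * 1#                    ≈⟨ *-identityʳ _ ⟩
    e (m % q)                         ∎

  e-mod : ∀ {m n} → m ~ n → e m ≈ e n
  e-mod {m} {n} m~n = trans (e-% m) (trans (reflexive (≡.cong e (residue≡ m~n))) (sym (e-% n)))

  sumL-cong : ∀ {f g : ℕ → Carrier} → (∀ k → f k ≈ g k) → ∀ ks → sumL R (map f ks) ≈ sumL R (map g ks)
  sumL-cong f≈g []       = refl
  sumL-cong f≈g (k ∷ ks) = +-cong (f≈g k) (sumL-cong f≈g ks)

  sumL-1 : ∀ (ks : List ℕ) → sumL R (map (λ _ → 1#) ks) ≈ natR R (length ks)
  sumL-1 []       = refl
  sumL-1 (k ∷ ks) = +-congˡ (sumL-1 ks)

  sumL-filter : ∀ {P : ℕ → Set} (P? : ∀ k → Dec (P k)) (f : ℕ → Carrier) ks →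
    sumL R (map f (filter P? ks)) ≈ sumL R (map (λ k → if does (P? k) then f k else 0#) ks)
  sumL-filter P? f []       = refl
  sumL-filter P? f (k ∷ ks) with does (P? k)
  ... | true  = +-congˡ (sumL-filter P? f ks)
  ... | false = trans (sumL-filter P? f ks) (sym (+-identityˡ _))

  sumL-applyUpTo : ∀ (f : ℕ → Carrier) g n → sumL R (map f (map ℕ.suc (applyUpTo g n))) ≈ ∑ {n} (λ i → f (suc (g (toℕ i))))
  sumL-applyUpTo f g zero    = sym (∑-zero λ ())
  sumL-applyUpTo f g (suc n) = trans (+-congˡ (sumL-applyUpTo f (g ∘ suc) n)) (reflexive (≡.sym (∑-suc _)))

  sumL-oneTo : ∀ (f : ℕ → Carrier) n → sumL R (map f (oneTo n)) ≈ ∑ {n} (λ i → f (suc (toℕ i)))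
  sumL-oneTo f n = sumL-applyUpTo f id n

  length-oneTo : ∀ n → length (oneTo n) ≡ n
  length-oneTo n = ≡.trans (length-map suc (upTo n)) (length-upTo n)

  -- Periodicity of `e` reduces `j` to its residue. For a nonzero residue this is the second half of
  -- `IsPrimitiveRoot`; that hypothesis supplies the vanishing directly, as ζ^j - 1 could be a zero
  -- divisor in `R`. For residue zero there are `q` summands `1#`.
  orthogonality : ∀ j → sumL R (map (λ m → e (m ℕ.* j)) (oneTo q)) ≈ (if does (j % q ℕ.≟ 0) then natR R q else 0#)
  orthogonality j = begin
    sumL R (map (λ m → e (m ℕ.* j)) (oneTo q))
      ≈⟨ sumL-cong (λ m → e-mod (*-mod {m} ~-refl (~-sym (mod (m%n%n≡m%n j q))))) (oneTo q) ⟩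
    sumL R (map (λ m → e (m ℕ.* (j % q))) (oneTo q))
      ≈⟨ by-residue (j % q) (m%n<n j q) ⟩
    (if does (j % q ℕ.≟ 0) then natR R q else 0#) ∎
    where
    by-residue : ∀ r → r ℕ.< q → sumL R (map (λ m → e (m ℕ.* r)) (oneTo q)) ≈ (if does (r ℕ.≟ 0) then natR R q else 0#)
    by-residue zero    _   = begin
      sumL R (map (λ m → e (m ℕ.* 0)) (oneTo q))   ≈⟨ sumL-cong (λ m → reflexive (≡.cong e (ℕₚ.*-zeroʳ m))) (oneTo q) ⟩
      sumL R (map (λ m → 1#) (oneTo q))            ≈⟨ sumL-1 (oneTo q) ⟩
      natR R (length (oneTo q))                    ≡⟨ ≡.cong (natR R) (length-oneTo q) ⟩
      natR R q                                     ∎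
    by-residue (suc r) r<q = proj₂ ζ-primitive (suc r) z<s r<q

  index : Fin q → ℕ
  index i = suc (toℕ i)

  U V : Matrix q q
  U m k = e (index m ℕ.* index k)
  V k n = if does (unit? (index k)) then e (index n ℕ.* inv q′ (index k)) else 0#

  *-if : ∀ (b : Bool) x y → x * (if b then y else 0#) ≈ (if b then x * y else 0#)
  *-if true  x y = refl
  *-if false x y = zeroʳ x

  if-cong : ∀ (b : Bool) {x y} → x ≈ y → (if b then x else 0#) ≈ (if b then y else 0#)
  if-cong true  x≈y = x≈y
  if-cong false x≈y = refl

  U·V≋Bmat : U · V ≋ Bmat R q′ ζ
  U·V≋Bmat m n = begin
    ∑ (λ k → U m k * V k n)
      ≈⟨ ∑-cong (λ k → trans (*-if (does (unit? (index k))) _ _) (if-cong (does (unit? (index k))) (sym (e-+ (index m ℕ.* index k) _)))) ⟩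
    ∑ (λ k → if does (unit? (index k)) then e (index m ℕ.* index k + index n ℕ.* inv q′ (index k)) else 0#)
      ≈⟨ sumL-oneTo (λ k → if does (unit? k) then e (index m ℕ.* k + index n ℕ.* inv q′ k) else 0#) q ⟨
    sumL R (map (λ k → if does (unit? k) then e (index m ℕ.* k + index n ℕ.* inv q′ k) else 0#) (oneTo q))
      ≈⟨ sumL-filter unit? (λ k → e (index m ℕ.* k + index n ℕ.* inv q′ k)) (oneTo q) ⟨
    Bmat R q′ ζ m n ∎

  V·U-entry : ∀ k l → (V · U) k l ≈ (if does (opposite? (index k) (index l)) then natR R q else 0#)
  V·U-entry k l = by-unit (unit? (index k)) ≡.refl
    where
    κ = index k
    -- The equation for `unit? κ` is carried along so that the decision inside `V` can be resolved
    -- under the sum over `m`.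
    by-unit : ∀ d → unit? κ ≡ d → (V · U) k l ≈ (if does (opposite? κ (index l)) then natR R q else 0#)
    by-unit (no ¬u) eq rewrite dec-false (opposite? κ (index l)) (¬u ∘ opposite⇒unit κ (index l)) =
      ∑-zero λ m → trans (*-congʳ (reflexive (≡.cong (λ d → if does d then e (index m ℕ.* inv q′ κ) else 0#) eq))) (zeroˡ _)
    by-unit (yes u) eq = begin
      ∑ (λ m → V k m * U m l)
        ≈⟨ ∑-cong (λ m → *-congʳ (reflexive (≡.cong (λ d → if does d then e (index m ℕ.* inv q′ κ) else 0#) eq))) ⟩
      ∑ (λ m → e (index m ℕ.* inv q′ κ) * e (index m ℕ.* index l))
        ≈⟨ ∑-cong (λ m → trans (sym (e-+ (index m ℕ.* inv q′ κ) _)) (reflexive (≡.cong e (≡.sym (ℕₚ.*-distribˡ-+ (index m) (inv q′ κ) (index l)))))) ⟩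
      ∑ (λ m → e (index m ℕ.* (inv q′ κ + index l)))
        ≈⟨ sumL-oneTo (λ m → e (m ℕ.* (inv q′ κ + index l))) q ⟨
      sumL R (map (λ m → e (m ℕ.* (inv q′ κ + index l))) (oneTo q))
        ≈⟨ orthogonality (inv q′ κ + index l) ⟩
      (if does ((inv q′ κ + index l) % q ℕ.≟ 0) then natR R q else 0#)
        ≡⟨ ≡.cong (λ b → if b then natR R q else 0#) (same (opposite? κ (index l))) ⟩
      (if does (opposite? κ (index l)) then natR R q else 0#) ∎
      where
      same : ∀ d → does ((inv q′ κ + index l) % q ℕ.≟ 0) ≡ does d
      same (yes o) = dec-true ((inv q′ κ + index l) % q ℕ.≟ 0) (opposite⇒inv κ (index l) u o)
      same (no ¬o) = dec-false ((inv q′ κ + index l) % q ℕ.≟ 0) (¬o ∘ inv⇒opposite κ (index l) u)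

  I-index : ∀ i j → I {q} i j ≈ (if does (index i ℕ.≟ index j) then 1# else 0#)
  I-index i j with i ≟ j
  ... | yes ≡.refl rewrite dec-true (index i ℕ.≟ index i) ≡.refl = I-diag i
  ... | no  i≢j    rewrite dec-false (index i ℕ.≟ index j) (i≢j ∘ toℕ-injective ∘ ℕₚ.suc-injective) = I-off i≢j

  -- Written exactly as the condition in `φ̃`, so that the count `#F (oneTo q)` is `φ̃ q′` by
  -- definition; in the same way `unit?` makes `#U (oneTo q)` equal to `φ q′`.
  self-opposite? : ∀ k → Dec ((k + inv q′ k) % q ≡ 0)
  self-opposite? k = (k + inv q′ k) % q ℕ.≟ 0

  module _ (λ′ : Carrier) where
    open MatchingDeterminant R λ′ (natR R q) unit? self-opposite? opposite?
      (λ {k} {l} → opposite-sym k l) (λ {k} {l} → opposite⇒unit k l)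
      (λ {k} u f → inv⇒opposite k k u (≡.trans (≡.cong (_% q) (ℕₚ.+-comm (inv q′ k) k)) f))
      (λ {k} o → ≡.trans (≡.cong (_% q) (ℕₚ.+-comm k (inv q′ k))) (opposite⇒inv k k (opposite⇒unit k k o) o))

    -- The sizes `q` and `length (oneTo q)` agree only propositionally; entries that depend on `toℕ`
    -- alone let the size change without transporting a matrix.
    Det-toℕ : ∀ {m n} → m ≡ n → (f : ℕ → ℕ → Carrier) →
              Det {m} (λ i j → f (toℕ i) (toℕ j)) ≈ Det {n} (λ i j → f (toℕ i) (toℕ j))
    Det-toℕ ≡.refl f = refl

    charPolyAt≈Det-listMatrix : charPolyAt R q′ ζ λ′ ≈ Det (listMatrix (oneTo q))
    charPolyAt≈Det-listMatrix = begin
      charPolyAt R q′ ζ λ′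
        ≡⟨ Det-def _ ⟨
      Det (λ′ ⊝ Bmat R q′ ζ)
        ≈⟨ Det-cong (λ i j → +-congˡ (-‿cong (U·V≋Bmat i j))) ⟨
      Det (λ′ ⊝ U · V)
        ≈⟨ Det-⊝-comm R λ′ U V ⟩
      Det (λ′ ⊝ V · U)
        ≈⟨ Det-cong (λ i j → +-cong (*-congˡ (I-index i j)) (-‿cong (V·U-entry i j))) ⟩
      Det {q} (λ i j → entry (index i) (index j))
        ≈⟨ Det-toℕ (length-oneTo q) (λ i j → entry (suc i) (suc j)) ⟨
      Det {length (oneTo q)} (λ i j → entry (suc (toℕ i)) (suc (toℕ j)))
        ≈⟨ Det-cong (λ i j → reflexive (lookups i j)) ⟨
      Det (listMatrix (oneTo q)) ∎
      where
      lookups : ∀ i j → listMatrix (oneTo q) i j ≡ entry (suc (toℕ i)) (suc (toℕ j))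
      lookups i j = ≡.cong₂ entry (lookup-map-suc-applyUpTo id q i) (lookup-map-suc-applyUpTo id q j)

    -- Substituting q = z + φ and φ = φ̃ + 2p shows that both truncated subtractions are genuine and
    -- both divisions by 2 exact: φ + φ̃ = 2 (φ̃ + p) and φ - φ̃ = 2p.
    power-counts : Factorisation (oneTo q) → charPolyAt R q′ ζ λ′ ≈
      pow R λ′ (q ∸ φ q′) * (pow R (λ′ - natR R q) ((φ q′ + φ̃ q′) / 2) * pow R (λ′ ⊕ natR R q) ((φ q′ ∸ φ̃ q′) / 2))
    power-counts (factors z p length≡ #U≡ Det≈) = trans charPolyAt≈Det-listMatrix (trans Det≈ (*-cong
      (exponent λ′ (≡.sym (≡.trans (≡.cong (_∸ φ q′) q≡z+φ) (ℕₚ.m+n∸n≡m z (φ q′)))))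
      (*-cong
        (exponent (λ′ - natR R q) (≡.sym (≡.trans (≡.cong (_/ 2) (≡.trans (≡.cong (_+ φ̃ q′) #U≡) (double (φ̃ q′) p))) (m*n/n≡m (φ̃ q′ + p) 2))))
        (exponent (λ′ ⊕ natR R q) (≡.sym (≡.trans (≡.cong (_/ 2) φ∸φ̃≡2p) (m*n/n≡m p 2)))))))
      where
      exponent : ∀ x {m n} → m ≡ n → pow R x m ≈ pow R x n
      exponent x m≡n = reflexive (≡.cong (pow R x) m≡n)
      q≡z+φ : q ≡ z + φ q′
      q≡z+φ = ≡.trans (≡.sym (length-oneTo q)) length≡
      double : ∀ f p → f + (p + p) + f ≡ (f + p) ℕ.* 2
      double = solve-∀
      twice : ∀ p → p + p ≡ p ℕ.* 2
      twice = solve-∀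
      φ∸φ̃≡2p : φ q′ ∸ φ̃ q′ ≡ p ℕ.* 2
      φ∸φ̃≡2p = ≡.trans (≡.cong (_∸ φ̃ q′) #U≡) (≡.trans (ℕₚ.m+n∸m≡n (φ̃ q′) (p + p)) (twice p))

    charPolyAt-factorisation : charPolyAt R q′ ζ λ′ ≈
      pow R λ′ (q ∸ φ q′) * (pow R (λ′ - natR R q) ((φ q′ + φ̃ q′) / 2) * pow R (λ′ ⊕ natR R q) ((φ q′ ∸ φ̃ q′) / 2))
    charPolyAt-factorisation = power-counts (factorisation (length (oneTo q)) (oneTo q) ℕₚ.≤-refl opposite-matching)

theorem3 : ∀ {c ℓ : Level} (R : CommutativeRing c ℓ) (q' : ℕ)
    (ζ : CommutativeRing.Carrier R) → IsPrimitiveRoot R q' ζ →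
    ∀ (λ' : CommutativeRing.Carrier R) →
    CommutativeRing._≈_ R (charPolyAt R q' ζ λ')
    (CommutativeRing._*_ R
    (pow R λ' (suc q' ∸ φ q'))
    (CommutativeRing._*_ R
    (pow R (CommutativeRing._-_ R λ' (natR R (suc q'))) ((φ q' + φ̃ q') / 2))
    (pow R (CommutativeRing._+_ R λ' (natR R (suc q'))) ((φ q' ∸ φ̃ q') / 2))))
theorem3 R q' ζ ζ-primitive λ' = KloostermanMatrix.charPolyAt-factorisation R q' ζ ζ-primitive λ'
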